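{- Let $n\ge 4$ be an integer and let $\frac13\leq p\leq\frac12$. Then $M_3(n,p)=\mu_p(\mathrm{BD}_3(n))$. Moreover, $\mathrm{BD}_3(n)$ is the only optimal family up to isomorphism, that is, if $\mathcal F\subset 2^{[n]}$ is a non-trivial $3$-wise intersecting family with $\mu_p(\mathcal F)=M_3(n,p)$, then $\mathcal F\cong\mathrm{BD}_3(n)$.
   Context: Let $[n]=\{1,2,\ldots,n\}$ and let $2^{[n]}$ be its power set. For $0<p<1$, $q=1-p$, the $p$-measure of a family $\mathcal G\subset 2^{[n]}$ is $\mu_p(\mathcal G)=\sum_{G\in\mathcal G}p^{|G|}q^{n-|G|}$. A family $\mathcal G\subset 2^{[n]}$ is $3$-wise intersecting if $G_1\cap G_2\cap G_3\neq\emptyset$ for all $G_1,G_2,G_3\in\mathcal G$ (not necessarily distinct); it is non-trivial if $\bigcap_{G\in\mathcal G}G=\emptyset$. $M_3(n,p)$ denotes the maximum of $\mu_p(\mathcal G)$ over all non-trivial $3$-wise intersecting families $\mathcal G\subset 2^{[n]}$. The family $\mathrm{BD}_3(n)$ is $\{F\in 2^{[n]}:|F\cap[4]|\geq 3\}$; its $p$-measure is $4p^3q+p^4$. Two families $\mathcal F,\mathcal G\subset 2^{[n]}$ are isomorphic, written $\mathcal F\cong\mathcal G$, if there is a permutation $\tau$ of $[n]$ such that $\mathcal F=\{\{\tau(g):g\in G\}:G\in\mathcal G\}$. -}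

module Defs where

open import Algebra.Bundles.Raw using (RawSemiring)
import Algebra.Definitions.RawSemiring as RawSemiringDefinitions
open import Data.Bool.Base using (Bool; T)
open import Data.Fin.Base using (toℕ)
open import Data.Fin.Permutation using (Permutation′; _⟨$⟩ˡ_)
open import Data.Fin.Subset using (Subset; inside; outside; Nonempty; Empty; _∩_; ⋂; ∣_∣)
open import Data.List.Base using (List; []; _∷_; _++_; map; filterᵇ; foldr)
open import Data.Nat.Base as ℕ using (ℕ; zero; suc)
import Data.Nat.Properties as ℕ
open import Data.Product.Base using (_×_; _,_; ∃-syntax; Σ-syntax)
open import Data.Rational.Base as ℚ using (ℚ; 0ℚ; 1ℚ; ½)
import Data.Rational.Properties as ℚ
open import Data.Rational.Solver using (module +-*-Solver)
open import Data.Vec.Base as Vec using (tabulate; lookup)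
open import Function.Bundles using (_⇔_)
open import Level using (0ℓ)
open import Relation.Binary.PropositionalEquality using (_≡_; refl; sym; trans; cong; subst)

------------------------------------------------------------------------
-- Real numbers: Cauchy sequences of rationals, with _≃_ as equality.

IsCauchy : (ℕ → ℚ) → Set
IsCauchy x = ∀ {ε} → 0ℚ ℚ.< ε →
  ∃[ N ] (∀ {m n} → N ℕ.≤ m → N ℕ.≤ n → ℚ.∣ x m ℚ.- x n ∣ ℚ.< ε)

record ℝ : Set where
  constructor mkℝ
  field
    seq    : ℕ → ℚ
    cauchy : IsCauchy seq

open ℝ public

infix 4 _≃_ _≤ᴿ_

_≃_ : ℝ → ℝ → Set
x ≃ y = ∀ {ε} → 0ℚ ℚ.< ε →
  ∃[ N ] (∀ {n} → N ℕ.≤ n → ℚ.∣ seq x n ℚ.- seq y n ∣ ℚ.< ε)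

_≤ᴿ_ : ℝ → ℝ → Set
x ≤ᴿ y = ∀ {ε} → 0ℚ ℚ.< ε →
  ∃[ N ] (∀ {n} → N ℕ.≤ n → seq x n ℚ.< seq y n ℚ.+ ε)

0<½* : ∀ {ε} → 0ℚ ℚ.< ε → 0ℚ ℚ.< ½ ℚ.* ε
0<½* {ε} ε>0 = ℚ.positive⁻¹ (½ ℚ.* ε) {{ℚ.pos*pos⇒pos ½ ε {{ℚ.positive ε>0}}}}

halves : ∀ ε → ½ ℚ.* ε ℚ.+ ½ ℚ.* ε ≡ ε
halves ε = trans (sym (ℚ.*-distribʳ-+ ε ½ ½)) (ℚ.*-identityˡ ε)

-- a sequence with |xₘ − xₙ| < 1 beyond N is bounded there by 1 + |x_N|
bounded : ∀ {x} → IsCauchy x →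
  ∃[ B ] (0ℚ ℚ.< B) × ∃[ N ] (∀ {n} → N ℕ.≤ n → ℚ.∣ x n ∣ ℚ.≤ B)
bounded {x} cx =
  let N , close = cx (ℚ.positive⁻¹ 1ℚ)
  in 1ℚ ℚ.+ ℚ.∣ x N ∣
   , ℚ.+-mono-<-≤ (ℚ.positive⁻¹ 1ℚ) (ℚ.0≤∣p∣ (x N))
   , N
   , λ {n} N≤n → begin
       ℚ.∣ x n ∣                          ≡⟨ cong ℚ.∣_∣ (split (x n) (x N)) ⟩
       ℚ.∣ (x n ℚ.- x N) ℚ.+ x N ∣        ≤⟨ ℚ.∣p+q∣≤∣p∣+∣q∣ (x n ℚ.- x N) (x N) ⟩
       ℚ.∣ x n ℚ.- x N ∣ ℚ.+ ℚ.∣ x N ∣    ≤⟨ ℚ.+-monoˡ-≤ ℚ.∣ x N ∣ (ℚ.<⇒≤ (close N≤n ℕ.≤-refl)) ⟩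
       1ℚ ℚ.+ ℚ.∣ x N ∣                   ∎
  where
  open ℚ.≤-Reasoning
  open +-*-Solver
  split : ∀ a b → a ≡ (a ℚ.- b) ℚ.+ b
  split = solve 2 (λ a b → a := (a :- b) :+ b) refl

-- |a| ≤ B and |d| < ½ε/B give |a d| < ½ε
scale : ∀ {B ε} → 0ℚ ℚ.< B → 0ℚ ℚ.< ε →
  ∃[ δ ] (0ℚ ℚ.< δ) × (∀ a d → ℚ.∣ a ∣ ℚ.≤ B → ℚ.∣ d ∣ ℚ.< δ → ℚ.∣ a ℚ.* d ∣ ℚ.< ½ ℚ.* ε)
scale {B} {ε} B>0 ε>0 = δ , δ>0 , λ a d a≤B d<δ → begin-strict
    ℚ.∣ a ℚ.* d ∣            ≡⟨ ℚ.∣p*q∣≡∣p∣*∣q∣ a d ⟩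
    ℚ.∣ a ∣ ℚ.* ℚ.∣ d ∣      ≤⟨ ℚ.*-monoʳ-≤-nonNeg ℚ.∣ d ∣ {{ℚ.nonNegative (ℚ.0≤∣p∣ d)}} a≤B ⟩
    B ℚ.* ℚ.∣ d ∣            <⟨ ℚ.*-monoʳ-<-pos B d<δ ⟩
    B ℚ.* (B⁻¹ ℚ.* (½ ℚ.* ε)) ≡⟨ sym (ℚ.*-assoc B B⁻¹ (½ ℚ.* ε)) ⟩
    B ℚ.* B⁻¹ ℚ.* (½ ℚ.* ε)  ≡⟨ cong (ℚ._* (½ ℚ.* ε)) (ℚ.*-inverseʳ B) ⟩
    1ℚ ℚ.* (½ ℚ.* ε)         ≡⟨ ℚ.*-identityˡ (½ ℚ.* ε) ⟩
    ½ ℚ.* ε                  ∎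
  where
  open ℚ.≤-Reasoning
  instance
    B-pos = ℚ.positive B>0
    B-nonZero = ℚ.pos⇒nonZero B
  B⁻¹ = ℚ.1/ B
  δ = B⁻¹ ℚ.* (½ ℚ.* ε)
  δ>0 : 0ℚ ℚ.< δ
  δ>0 = ℚ.positive⁻¹ δ
    {{ℚ.pos*pos⇒pos B⁻¹ {{ℚ.1/pos⇒pos B}} (½ ℚ.* ε) {{ℚ.positive (0<½* ε>0)}}}}

fromℚ : ℚ → ℝ
fromℚ r = mkℝ (λ _ → r) λ ε>0 →
  0 , λ _ _ → subst (ℚ._< _) (sym (cong ℚ.∣_∣ (ℚ.+-inverseʳ r))) ε>0

0ᴿ 1ᴿ : ℝ
0ᴿ = fromℚ 0ℚ
1ᴿ = fromℚ 1ℚ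

infixl 6 _+ᴿ_ _-ᴿ_
infixl 7 _*ᴿ_
infix  8 -ᴿ_

_+ᴿ_ : ℝ → ℝ → ℝ
mkℝ x cx +ᴿ mkℝ y cy = mkℝ (λ n → x n ℚ.+ y n) λ {ε} ε>0 →
  let N₁ , close₁ = cx (0<½* ε>0)
      N₂ , close₂ = cy (0<½* ε>0)
  in N₁ ℕ.⊔ N₂ , λ {m} {n} N≤m N≤n → begin-strict
       ℚ.∣ (x m ℚ.+ y m) ℚ.- (x n ℚ.+ y n) ∣        ≡⟨ cong ℚ.∣_∣ (regroup (x m) (y m) (x n) (y n)) ⟩
       ℚ.∣ (x m ℚ.- x n) ℚ.+ (y m ℚ.- y n) ∣        ≤⟨ ℚ.∣p+q∣≤∣p∣+∣q∣ (x m ℚ.- x n) (y m ℚ.- y n) ⟩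
       ℚ.∣ x m ℚ.- x n ∣ ℚ.+ ℚ.∣ y m ℚ.- y n ∣      <⟨ ℚ.+-mono-< (close₁ (ℕ.m⊔n≤o⇒m≤o N₁ N₂ N≤m) (ℕ.m⊔n≤o⇒m≤o N₁ N₂ N≤n))
                                                                  (close₂ (ℕ.m⊔n≤o⇒n≤o N₁ N₂ N≤m) (ℕ.m⊔n≤o⇒n≤o N₁ N₂ N≤n)) ⟩
       ½ ℚ.* ε ℚ.+ ½ ℚ.* ε                          ≡⟨ halves ε ⟩
       ε                                            ∎
  where
  open ℚ.≤-Reasoning
  open +-*-Solver
  regroup : ∀ a b c d → (a ℚ.+ b) ℚ.- (c ℚ.+ d) ≡ (a ℚ.- c) ℚ.+ (b ℚ.- d)
  regroup = solve 4 (λ a b c d → (a :+ b) :- (c :+ d) := (a :- c) :+ (b :- d)) refl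

-ᴿ_ : ℝ → ℝ
-ᴿ mkℝ x cx = mkℝ (λ n → ℚ.- x n) λ ε>0 →
  let N , close = cx ε>0
  in N , λ {m} {n} N≤m N≤n → subst (ℚ._< _)
       (trans (sym (ℚ.∣-p∣≡∣p∣ (x m ℚ.- x n))) (cong ℚ.∣_∣ (ℚ.neg-distrib-+ (x m) (ℚ.- x n))))
       (close N≤m N≤n)

_-ᴿ_ : ℝ → ℝ → ℝ
x -ᴿ y = x +ᴿ (-ᴿ y)

_*ᴿ_ : ℝ → ℝ → ℝ
mkℝ x cx *ᴿ mkℝ y cy = mkℝ (λ n → x n ℚ.* y n) λ {ε} ε>0 →
  let A , A>0 , M₁ , x≤A = bounded cx
      B , B>0 , M₂ , y≤B = bounded cy
      α , α>0 , small₁ = scale A>0 ε>0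
      β , β>0 , small₂ = scale B>0 ε>0
      N₁ , close₁ = cx β>0
      N₂ , close₂ = cy α>0
      M = M₁ ℕ.⊔ M₂
      N = N₁ ℕ.⊔ N₂
  in M ℕ.⊔ N , λ {m} {n} K≤m K≤n →
     let M≤m = ℕ.m⊔n≤o⇒m≤o M N K≤m
         M≤n = ℕ.m⊔n≤o⇒m≤o M N K≤n
         N≤m = ℕ.m⊔n≤o⇒n≤o M N K≤m
         N≤n = ℕ.m⊔n≤o⇒n≤o M N K≤n
     in begin-strict
       ℚ.∣ x m ℚ.* y m ℚ.- x n ℚ.* y n ∣                                  ≡⟨ cong ℚ.∣_∣ (regroup (x m) (y m) (x n) (y n)) ⟩
       ℚ.∣ x m ℚ.* (y m ℚ.- y n) ℚ.+ y n ℚ.* (x m ℚ.- x n) ∣              ≤⟨ ℚ.∣p+q∣≤∣p∣+∣q∣ (x m ℚ.* (y m ℚ.- y n)) (y n ℚ.* (x m ℚ.- x n)) ⟩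
       ℚ.∣ x m ℚ.* (y m ℚ.- y n) ∣ ℚ.+ ℚ.∣ y n ℚ.* (x m ℚ.- x n) ∣
         <⟨ ℚ.+-mono-<
              (small₁ (x m) (y m ℚ.- y n) (x≤A (ℕ.m⊔n≤o⇒m≤o M₁ M₂ M≤m))
                (close₂ (ℕ.m⊔n≤o⇒n≤o N₁ N₂ N≤m) (ℕ.m⊔n≤o⇒n≤o N₁ N₂ N≤n)))
              (small₂ (y n) (x m ℚ.- x n) (y≤B (ℕ.m⊔n≤o⇒n≤o M₁ M₂ M≤n))
                (close₁ (ℕ.m⊔n≤o⇒m≤o N₁ N₂ N≤m) (ℕ.m⊔n≤o⇒m≤o N₁ N₂ N≤n))) ⟩
       ½ ℚ.* ε ℚ.+ ½ ℚ.* ε                                                ≡⟨ halves ε ⟩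
       ε                                                                  ∎
  where
  open ℚ.≤-Reasoning
  open +-*-Solver
  regroup : ∀ a b c d → a ℚ.* b ℚ.- c ℚ.* d ≡ a ℚ.* (b ℚ.- d) ℚ.+ d ℚ.* (a ℚ.- c)
  regroup = solve 4 (λ a b c d → a :* b :- c :* d := a :* (b :- d) :+ d :* (a :- c)) refl

ℝ-rawSemiring : RawSemiring 0ℓ 0ℓ
ℝ-rawSemiring = record
  { Carrier = ℝ ; _≈_ = _≃_ ; _+_ = _+ᴿ_ ; _*_ = _*ᴿ_ ; 0# = 0ᴿ ; 1# = 1ᴿ }

open RawSemiringDefinitions ℝ-rawSemiring public using () renaming (_^_ to _^ᴿ_)

sumᴿ : List ℝ → ℝ
sumᴿ = foldr _+ᴿ_ 0ᴿ

------------------------------------------------------------------------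
-- Families of subsets.  The ground set {1, …, n} is Fin n, so the element
-- i of the former is the one with toℕ value i − 1 of the latter.

Family : ℕ → Set
Family n = Subset n → Bool

infix 4 _∈ᶠ_

_∈ᶠ_ : ∀ {n} → Subset n → Family n → Set
G ∈ᶠ 𝓖 = T (𝓖 G)

subsets : ∀ n → List (Subset n)
subsets zero    = Vec.[] ∷ []
subsets (suc n) = map (inside Vec.∷_) (subsets n) ++ map (outside Vec.∷_) (subsets n)

members : ∀ {n} → Family n → List (Subset n)
members {n} 𝓖 = filterᵇ 𝓖 (subsets n)

μ : ∀ {n} → ℝ → Family n → ℝ
μ {n} p 𝓖 = sumᴿ (map (λ G → p ^ᴿ ∣ G ∣ *ᴿ q ^ᴿ (n ℕ.∸ ∣ G ∣)) (members 𝓖))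
  where q = 1ᴿ -ᴿ p

3-WiseIntersecting : ∀ {n} → Family n → Set
3-WiseIntersecting 𝓖 = ∀ {G₁ G₂ G₃} → G₁ ∈ᶠ 𝓖 → G₂ ∈ᶠ 𝓖 → G₃ ∈ᶠ 𝓖 → Nonempty (G₁ ∩ G₂ ∩ G₃)

NonTrivial : ∀ {n} → Family n → Set
NonTrivial 𝓖 = Empty (⋂ (members 𝓖))

-- m is the maximum of μ p over the non-trivial 3-wise intersecting families.
-- A relation, because there are no such families at all when n is small.
IsM₃ : ℕ → ℝ → ℝ → Set
IsM₃ n p m =
    (Σ[ 𝓖 ∈ Family n ] NonTrivial 𝓖 × 3-WiseIntersecting 𝓖 × μ p 𝓖 ≃ m)
  × ((𝓖 : Family n) → NonTrivial 𝓖 → 3-WiseIntersecting 𝓖 → μ p 𝓖 ≤ᴿ m)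

[4] : ∀ {n} → Subset n
[4] = tabulate (λ i → toℕ i ℕ.<ᵇ 4)

BD₃ : ∀ n → Family n
BD₃ n F = 3 ℕ.≤ᵇ ∣ F ∩ [4] ∣

-- { τ(g) : g ∈ G }, using that i = τ(g) for some g ∈ G iff τ⁻¹(i) ∈ G
_[_] : ∀ {n} → Permutation′ n → Subset n → Subset n
τ [ G ] = tabulate (λ i → lookup G (τ ⟨$⟩ˡ i))

infix 4 _≅_

_≅_ : ∀ {n} → Family n → Family n → Set
_≅_ {n} 𝓕 𝓖 = Σ[ τ ∈ Permutation′ n ] (∀ F → F ∈ᶠ 𝓕 ⇔ (∃[ G ] G ∈ᶠ 𝓖 × F ≡ τ [ G ]))

{-# OPTIONS --safe #-}
module Submission where

-- A non-trivial 3-wise intersecting family F stays so under upward closure and adjacent shifts, and any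
-- two of its members share at least two elements. If F is upward closed and its 3-sets have no common
-- element, then F is a copy of BD₃. If they have one, then they still have one after a shift, so it
-- suffices that a shifted F with {2,3,4} ∉ F has smaller measure than BD₃.
-- Write D, U₁, U₂, V for the links of F at {1,2}, {1}, {2}, ∅ and d, u₁, u₂, v for their measures.
-- The members of D meet those of U₁, so d ≤ 1 − w with w the measure of U₁ for the exchanged weights q, p.
-- A shifted family whose members pairwise share t elements satisfies q^t μ_p ≤ p^t μ_q, by induction
-- through its links; this bounds w below by (q/p)² u₁, and by (q/p)³ u₁ if V is inhabited.
-- The members of F avoiding 1 are 3-wise 3-intersecting, so their measure b = p u₂ + q v is at most p³.
-- Hence μ_p (BD₃) − μ_p (F) is at least a positive multiple of (3p − 1)(p³ − b) + (1 − 2p)(u₁ − b) if V is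
-- inhabited, and of (3p − 1)(p² − u₂) + (1 − 2p)(u₁ − u₂) otherwise, with coefficients that are
-- non-negative for 1/3 ≤ p ≤ 1/2.
-- Since p is a Cauchy real, each strict inequality comes with a gap that does not depend on p.

open import Defs
import Algebra.Definitions.RawSemiring as RawSemiringDefinitions
open import Data.Bool.Base using (Bool; true; false; T; _∧_; _∨_; if_then_else_)
open import Data.Bool.Properties using (T-∧; T-∨; T?; ∧-comm; ∧-assoc; ∧-zeroʳ; ∨-comm)
open import Data.Empty using (⊥-elim)
open import Data.Fin.Base using (Fin; zero; suc; fromℕ<)
open import Data.Fin.Permutation using (Permutation′; _⟨$⟩ˡ_; _⟨$⟩ʳ_; _∘ₚ_; lift₀; transpose; inverseʳ; flip)
import Data.Fin.Permutation as Permutation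
open import Data.Fin.Permutation.Components using (transpose-inverse) renaming (transpose to transposeᶠ)
open import Data.Fin.Properties using (any?; _≟_)
open import Data.Fin.Subset using (Subset; inside; outside; Nonempty; _∈_; _∉_; _⊆_; _∩_; _∪_; _-_; ∣_∣; ⁅_⁆; ⋂; ⊤)
  renaming (⊥ to ∅)
open import Data.Fin.Subset.Properties
open import Data.Integer.Base using (+_)
open import Data.List.Base using (List; _++_; filterᵇ) renaming (map to mapˡ; [] to []ˡ; _∷_ to _∷ˡ_)
open import Data.List.Membership.Propositional using () renaming (_∈_ to _∈ˡ_)
open import Data.List.Membership.Propositional.Properties using (∈-map⁺; ∈-++⁺ˡ; ∈-++⁺ʳ)
open import Data.List.Relation.Unary.Any using () renaming (here to hereˡ; there to thereˡ)
open import Data.Nat.Base as ℕ using (ℕ; zero; suc; s≤s; z≤n; s≤s⁻¹; _≤_)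
open import Data.Nat.Induction using (<-wellFounded)
import Data.Nat.Properties as ℕ
open import Data.Nat.Tactic.RingSolver using (solve-∀)
open import Data.Product.Base using (_×_; _,_; ∃-syntax; Σ-syntax; proj₁; proj₂)
open import Data.Rational.Base as ℚ using (ℚ; 0ℚ; 1ℚ; _/_)
import Data.Rational.Properties as ℚ
open import Data.Rational.Solver using (module +-*-Solver)
open import Data.Sum.Base using (_⊎_; inj₁; inj₂; [_,_]′)
open import Data.Unit.Base using (tt) renaming (⊤ to Unit)
open import Data.Vec.Base using ([]; _∷_; here; there; lookup; tabulate)
open import Data.Vec.Properties using (lookup∘tabulate; tabulate∘lookup; tabulate-cong; []=⇒lookup; lookup-zipWith)
open import Function.Base using (_∘_; id; case_of_)
open import Function.Bundles using (_⇔_; mk⇔; module Equivalence)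
open import Induction.WellFounded using (Acc; acc)
open import Relation.Binary.PropositionalEquality
  using (_≡_; refl; sym; trans; cong; cong₂; subst; subst₂; _≢_; module ≡-Reasoning)
open import Relation.Nullary using (¬_; Dec; yes; no; contradiction)
open import Relation.Nullary.Decidable using (_×-dec_; ¬?; decidable-stable; from-yes)

import Algebra.Properties.CommutativeMonoid.Sum ℕ.+-0-commutativeMonoid as Sum
open RawSemiringDefinitions ℚ.+-*-rawSemiring using (_^_)
open +-*-Solver using (solve; con; _:+_; _:*_; _:-_; :-_; _:=_)

private
  variable
    n : ℕ
    F G H : Family n

T-∧⁺ : ∀ {a b} → T a → T b → T (a ∧ b)
T-∧⁺ a b = Equivalence.from T-∧ (a , b)

T-∧⁻ : ∀ {a b} → T (a ∧ b) → T a × T b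
T-∧⁻ = Equivalence.to T-∧

T-∨⁺ : ∀ {a b} → T a ⊎ T b → T (a ∨ b)
T-∨⁺ = Equivalence.from T-∨

T-∨⁻ : ∀ {a b} → T (a ∨ b) → T a ⊎ T b
T-∨⁻ = Equivalence.to T-∨

-- Families, their inclusion and their links

infix 4 _⊑_
infixr 7 _∩ᶠ_
infixr 6 _∪ᶠ_

_⊑_ : Family n → Family n → Set
F ⊑ G = ∀ A → A ∈ᶠ F → A ∈ᶠ G

_∩ᶠ_ _∪ᶠ_ : Family n → Family n → Family n
(F ∩ᶠ G) A = F A ∧ G A
(F ∪ᶠ G) A = F A ∨ G A

link : Bool → Family (suc n) → Family n
link b F A = F (b ∷ A)

Inhabited : Family n → Set
Inhabited F = ∃[ A ] A ∈ᶠ F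

inhabited? : (F : Family n) → Dec (Inhabited F)
inhabited? F = anySubset? (λ A → T? (F A))

------------------------------------------------------------------------
-- Upward closed families

-- Defined along the coordinates, so that an induction through the links has the upward closure of
-- both at hand; `up` recovers the usual form.
data UpClosed : Family n → Set where
  nil  : {F : Family 0} → UpClosed F
  cons : {F : Family (suc n)} → UpClosed (link inside F) → UpClosed (link outside F) →
         link outside F ⊑ link inside F → UpClosed F

up : UpClosed F → ∀ {A B} → A ⊆ B → A ∈ᶠ F → B ∈ᶠ F
up nil {[]} {[]} _ A∈F = A∈F
up (cons u₁ u₀ o⊑i) {inside ∷ A} {inside ∷ B} A⊆B = up u₁ (drop-∷-⊆ A⊆B)
up (cons u₁ u₀ o⊑i) {inside ∷ A} {outside ∷ B} A⊆B = case A⊆B here of λ ()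
up (cons u₁ u₀ o⊑i) {outside ∷ A} {inside ∷ B} A⊆B = up u₁ (drop-∷-⊆ A⊆B) ∘ o⊑i A
up (cons u₁ u₀ o⊑i) {outside ∷ A} {outside ∷ B} A⊆B = up u₀ (drop-∷-⊆ A⊆B)

∩-upClosed : UpClosed F → UpClosed G → UpClosed (F ∩ᶠ G)
∩-upClosed nil nil = nil
∩-upClosed (cons u₁ u₀ o⊑i) (cons v₁ v₀ o⊑i′) = cons (∩-upClosed u₁ v₁) (∩-upClosed u₀ v₀)
  λ A A∈ → let a , b = T-∧⁻ A∈ in T-∧⁺ (o⊑i A a) (o⊑i′ A b)

∪-upClosed : UpClosed F → UpClosed G → UpClosed (F ∪ᶠ G)
∪-upClosed nil nil = nil
∪-upClosed (cons u₁ u₀ o⊑i) (cons v₁ v₀ o⊑i′) = cons (∪-upClosed u₁ v₁) (∪-upClosed u₀ v₀)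
  λ A A∈ → T-∨⁺ ([ inj₁ ∘ o⊑i A , inj₂ ∘ o⊑i′ A ]′ (T-∨⁻ A∈))

upClosure : Family n → Family n
upClosure {zero} F = F
upClosure {suc n} F (inside ∷ A) = upClosure (link inside F) A ∨ upClosure (link outside F) A
upClosure {suc n} F (outside ∷ A) = upClosure (link outside F) A

upClosure-upClosed : (F : Family n) → UpClosed (upClosure F)
upClosure-upClosed {zero} F = nil
upClosure-upClosed {suc n} F = cons
  (∪-upClosed (upClosure-upClosed (link inside F)) (upClosure-upClosed (link outside F)))
  (upClosure-upClosed (link outside F))
  λ A → T-∨⁺ ∘ inj₂

⊑-upClosure : (F : Family n) → F ⊑ upClosure F
⊑-upClosure F [] A∈F = A∈F
⊑-upClosure F (inside ∷ A) A∈F = T-∨⁺ (inj₁ (⊑-upClosure (link inside F) A A∈F))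
⊑-upClosure F (outside ∷ A) A∈F = ⊑-upClosure (link outside F) A A∈F

upClosure⁻ : (F : Family n) → ∀ A → A ∈ᶠ upClosure F → ∃[ B ] B ⊆ A × B ∈ᶠ F
upClosure⁻ F [] A∈ = [] , id , A∈
upClosure⁻ F (inside ∷ A) A∈ with T-∨⁻ A∈
... | inj₁ A∈₁ = let B , B⊆A , B∈F = upClosure⁻ (link inside F) A A∈₁ in inside ∷ B , in⊆in B⊆A , B∈F
... | inj₂ A∈₀ = let B , B⊆A , B∈F = upClosure⁻ (link outside F) A A∈₀ in outside ∷ B , out⊆ B⊆A , B∈F
upClosure⁻ F (outside ∷ A) A∈ =
  let B , B⊆A , B∈F = upClosure⁻ (link outside F) A A∈ in outside ∷ B , out⊆ B⊆A , B∈F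

------------------------------------------------------------------------
-- Intersections

CrossIntersecting : ℕ → (F G H : Family n) → Set
CrossIntersecting t F G H = ∀ A B C → A ∈ᶠ F → B ∈ᶠ G → C ∈ᶠ H → t ℕ.≤ ∣ A ∩ B ∩ C ∣

3-Wise 2-Wise : ℕ → Family n → Set
3-Wise t F = CrossIntersecting t F F F
2-Wise t F = ∀ A B → A ∈ᶠ F → B ∈ᶠ F → t ℕ.≤ ∣ A ∩ B ∣

Nonempty⇒0<∣∣ : {A : Subset n} → Nonempty A → 0 ℕ.< ∣ A ∣
Nonempty⇒0<∣∣ {A = inside ∷ A} _ = s≤s z≤n
Nonempty⇒0<∣∣ {A = outside ∷ A} (suc x , there x∈A) = Nonempty⇒0<∣∣ (x , x∈A)

∣p∣≡1+∣p-x∣ : ∀ {A : Subset n} {x} → x ∈ A → ∣ A ∣ ≡ suc ∣ A - x ∣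
∣p∣≡1+∣p-x∣ {A = inside ∷ A} here = cong (suc ∘ ∣_∣) (sym (p─⊥≡p A))
∣p∣≡1+∣p-x∣ {A = inside ∷ A} (there x∈A) = cong suc (∣p∣≡1+∣p-x∣ x∈A)
∣p∣≡1+∣p-x∣ {A = outside ∷ A} (there x∈A) = ∣p∣≡1+∣p-x∣ x∈A

0<∣∣⇒Nonempty : {A : Subset n} → 0 ℕ.< ∣ A ∣ → Nonempty A
0<∣∣⇒Nonempty {A = inside ∷ A} _ = zero , here
0<∣∣⇒Nonempty {A = outside ∷ A} 0<∣A∣ = let x , x∈A = 0<∣∣⇒Nonempty {A = A} 0<∣A∣ in suc x , there x∈A

∩-- : ∀ (A B : Subset n) x → (A ∩ B) - x ≡ (A - x) ∩ B
∩-- (a ∷ A) (b ∷ B) zero = cong (outside ∷_) (trans (p─⊥≡p (A ∩ B)) (cong (_∩ B) (sym (p─⊥≡p A))))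
∩-- (a ∷ A) (b ∷ B) (suc x) = cong (a ∧ b ∷_) (∩-- A B x)

-- The size is expressed through `A - x` because `exchange` replaces `A` by `A - x` with a new first
-- element.
common : ∀ (A B : Subset n) → 0 ℕ.< ∣ A ∩ B ∣ → ∃[ x ] x ∈ A × x ∈ B × ∣ A ∩ B ∣ ≡ suc ∣ (A - x) ∩ B ∣
common A B 0<∣A∩B∣ =
  let x , x∈ = 0<∣∣⇒Nonempty {A = A ∩ B} 0<∣A∩B∣
      x∈A , x∈B = x∈p∩q⁻ A B x∈
  in x , x∈A , x∈B , trans (∣p∣≡1+∣p-x∣ x∈) (cong (suc ∘ ∣_∣) (∩-- A B x))

------------------------------------------------------------------------
-- Adjacent shifts

Adjacent : Family (suc n) → Set
Adjacent {zero}  F = Unit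
Adjacent {suc n} F = ∀ A → outside ∷ inside ∷ A ∈ᶠ F → inside ∷ outside ∷ A ∈ᶠ F

data Shifted : Family n → Set where
  nil  : {F : Family 0} → Shifted F
  cons : {F : Family (suc n)} → Shifted (link inside F) → Shifted (link outside F) → Adjacent F → Shifted F

-- Each position between the front and `x` is passed in turn: if it is occupied, its element goes to
-- the front and `x` takes its place; if not, `x` moves there first and then to the front.
exchange : {F : Family (suc n)} → Shifted F →
  ∀ {A x} → x ∈ A → outside ∷ A ∈ᶠ F → inside ∷ (A - x) ∈ᶠ F
exchange {suc n} {F} (cons s₁ s₀ adj) {inside ∷ A} here A∈F =
  subst (λ B → inside ∷ outside ∷ B ∈ᶠ F) (sym (p─⊥≡p A)) (adj A A∈F)
exchange (cons s₁ s₀ adj) {inside ∷ A} (there x∈A) A∈F = exchange s₁ x∈A (adj A A∈F)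
exchange (cons s₁ s₀ adj) {outside ∷ A} (there x∈A) A∈F = adj _ (exchange s₀ x∈A A∈F)

-- `X` is the membership test as a function of two neighbouring bits, the rest of the set being
-- fixed. Of two sets that differ by a swap of the bits, `true false` is a member afterwards if
-- either was one before, `false true` if both were.
shiftBits : (Bool → Bool → Bool) → Bool → Bool → Bool
shiftBits X true  false = X true false ∨ X false true
shiftBits X false true  = X false true ∧ X true false
shiftBits X a     b     = X a b

-- Element k + 1 is replaced by k.
shift : ℕ → Family n → Family n
shift zero F (a ∷ b ∷ A) = shiftBits (λ a b → F (a ∷ b ∷ A)) a b
shift zero F A = F A
shift (suc k) F [] = F []
shift (suc k) F (b ∷ A) = shift k (link b F) A

shift-mono : ∀ k → F ⊑ G → shift k F ⊑ shift k G
shift-mono zero F⊑G [] = F⊑G _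
shift-mono zero F⊑G (inside ∷ []) = F⊑G _
shift-mono zero F⊑G (outside ∷ []) = F⊑G _
shift-mono zero F⊑G (inside ∷ inside ∷ A) = F⊑G _
shift-mono zero F⊑G (inside ∷ outside ∷ A) A∈ = T-∨⁺ ([ inj₁ ∘ F⊑G _ , inj₂ ∘ F⊑G _ ]′ (T-∨⁻ A∈))
shift-mono zero F⊑G (outside ∷ inside ∷ A) A∈ = let a , b = T-∧⁻ A∈ in T-∧⁺ (F⊑G _ a) (F⊑G _ b)
shift-mono zero F⊑G (outside ∷ outside ∷ A) = F⊑G _
shift-mono (suc k) F⊑G [] = F⊑G _
shift-mono (suc k) F⊑G (b ∷ A) = shift-mono k (λ B → F⊑G (b ∷ B)) A

shift-upClosed : ∀ {n} {F : Family n} k → UpClosed F → UpClosed (shift k F)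
shift-upClosed zero nil = nil
shift-upClosed (suc k) nil = nil
shift-upClosed {n = suc zero} zero (cons nil nil o⊑i) = cons nil nil λ { [] → o⊑i [] }
shift-upClosed {n = suc (suc n)} zero
  (cons (cons uᵢᵢ uᵢₒ io⊑ii) (cons uₒᵢ uₒₒ oo⊑oi) o⊑i) =
  cons (cons uᵢᵢ (∪-upClosed uᵢₒ uₒᵢ) λ A → [ io⊑ii A , o⊑i (inside ∷ A) ]′ ∘ T-∨⁻)
       (cons (∩-upClosed uₒᵢ uᵢₒ) uₒₒ λ A A∈ → T-∧⁺ (oo⊑oi A A∈) (o⊑i (outside ∷ A) A∈))
       λ { (inside ∷ A) → o⊑i (inside ∷ A) ∘ proj₁ ∘ T-∧⁻
         ; (outside ∷ A) → T-∨⁺ ∘ inj₁ ∘ o⊑i (outside ∷ A) }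
shift-upClosed (suc k) (cons u₁ u₀ o⊑i) =
  cons (shift-upClosed k u₁) (shift-upClosed k u₀) (shift-mono k o⊑i)

-- For an upward closed family: no element lies in all members.
data Spread : Family n → Set where
  nil  : {F : Family 0} → Spread F
  cons : {F : Family (suc n)} → Spread (link inside F) → outside ∷ ⊤ ∈ᶠ F → Spread F

shift-⊤ : ∀ k (F : Family n) → shift k F ⊤ ≡ F ⊤
shift-⊤ {zero} zero F = refl
shift-⊤ {suc zero} zero F = refl
shift-⊤ {suc (suc n)} zero F = refl
shift-⊤ {zero} (suc k) F = refl
shift-⊤ {suc n} (suc k) F = shift-⊤ k (link inside F)

-- As all `⊤ - x` are members, a swapped pair of them is present in full and survives the shift.
shift-spread : ∀ {n} {F : Family n} k → Spread F → Spread (shift k F)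
shift-spread zero nil = nil
shift-spread (suc k) nil = nil
shift-spread {n = suc zero} zero (cons nil x) = cons nil x
shift-spread {n = suc (suc n)} zero (cons (cons s x) y) = cons (cons s (T-∨⁺ (inj₁ x))) (T-∧⁺ y x)
shift-spread {F = F} (suc k) (cons s x) = cons (shift-spread k s) (subst T (sym (shift-⊤ k (link outside F))) x)

spread⇒⊤-x : Spread F → ∀ x → ⊤ - x ∈ᶠ F
spread⇒⊤-x {F = F} (cons s t) zero = subst (λ A → outside ∷ A ∈ᶠ F) (sym (p─⊥≡p ⊤)) t
spread⇒⊤-x (cons s t) (suc x) = spread⇒⊤-x s x

⊤-x⇒spread : (F : Family n) → (∀ x → ⊤ - x ∈ᶠ F) → Spread F
⊤-x⇒spread {zero} F h = nil
⊤-x⇒spread {suc n} F h = cons (⊤-x⇒spread (link inside F) (λ x → h (suc x)))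
  (subst (λ A → outside ∷ A ∈ᶠ F) (p─⊥≡p ⊤) (h zero))

-- The last clause records that a member with both bits set is never moved.
shiftBits⁻ : ∀ X a b → T (shiftBits X a b) →
  ∃[ a′ ] ∃[ b′ ] T (X a′ b′) × (T a′ → T b′ → T a × T b)
shiftBits⁻ X true  true  h = true , true , h , _,_
shiftBits⁻ X false false h = false , false , h , λ ()
shiftBits⁻ X false true  h = false , true , proj₁ (T-∧⁻ h) , λ ()
shiftBits⁻ X true  false h with T-∨⁻ h
... | inj₁ x = true , false , x , λ _ ()
... | inj₂ x = false , true , x , λ ()

CrossBits : (X Y Z : Bool → Bool → Bool) → Set
CrossBits X Y Z = ∀ {a b c d e f} → T (X a b) → T (Y c d) → T (Z e f) → T ((a ∧ c ∧ e) ∨ (b ∧ d ∧ f))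

-- If the first set has only the second bit, then it and its swap were both members before. Tested
-- against both, the originals of the other two sets must have both bits, so they were not moved.
shift-crossBits-outside : ∀ {X Y Z} → CrossBits X Y Z → ∀ {b c d e f} →
  T (shiftBits X false b) → T (shiftBits Y c d) → T (shiftBits Z e f) → T (b ∧ d ∧ f)
shift-crossBits-outside {X} {Y} {Z} h {false} {c} {d} {e} {f} x y z =
  let _ , _ , y′ , _ = shiftBits⁻ Y c d y
      _ , _ , z′ , _ = shiftBits⁻ Z e f z
  in h x y′ z′
shift-crossBits-outside {X} {Y} {Z} h {true} {c} {d} {e} {f} x y z =
  let x₀ , x₁ = T-∧⁻ x
      _ , _ , y′ , Y⁻ = shiftBits⁻ Y c d y
      _ , _ , z′ , Z⁻ = shiftBits⁻ Z e f z
      d′ , f′ = T-∧⁻ (h x₀ y′ z′)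
      c′ , e′ = T-∧⁻ ([ id , (λ ()) ]′ (T-∨⁻ (h x₁ y′ z′)))
  in T-∧⁺ (proj₂ (Y⁻ c′ d′)) (proj₂ (Z⁻ e′ f′))

∧-swap : ∀ x y z → x ∧ y ∧ z ≡ y ∧ x ∧ z
∧-swap true  y z = refl
∧-swap false y z = sym (∧-zeroʳ y)

∧-rev : ∀ x y z → x ∧ y ∧ z ≡ z ∧ y ∧ x
∧-rev x y z = trans (∧-comm x (y ∧ z)) (trans (∧-assoc y z x) (∧-swap y z x))

-- Either all three sets have the first bit, or one that lacks it is brought to the front by
-- symmetry.
shift-crossBits : ∀ {X Y Z} → CrossBits X Y Z → CrossBits (shiftBits X) (shiftBits Y) (shiftBits Z)
shift-crossBits h {false} {b} {c} {d} {e} {f} x y z = shift-crossBits-outside h {b} {c} {d} {e} {f} x y z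
shift-crossBits h {true} {b} {false} {d} {e} {f} x y z =
  subst T (∧-swap d b f) (shift-crossBits-outside
    (λ {c} {d} {a} {b} {e} {f} y x z → subst T (cong₂ _∨_ (∧-swap a c e) (∧-swap b d f)) (h x y z))
    {d} {true} {b} {e} {f} y x z)
shift-crossBits h {true} {b} {true} {d} {false} {f} x y z =
  subst T (∧-rev f d b) (shift-crossBits-outside
    (λ {e} {f} {c} {d} {a} {b} z y x → subst T (cong₂ _∨_ (∧-rev a c e) (∧-rev b d f)) (h x y z))
    {f} {true} {d} {true} {b} z y x)
shift-crossBits h {true} {_} {true} {_} {true} x y z = tt

link-cross : ∀ {t} {F G H : Family (suc n)} a b c → a ∧ b ∧ c ≡ false →
  CrossIntersecting t F G H → CrossIntersecting t (link a F) (link b G) (link c H)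
link-cross {t = t} a b c abc≡f cross A B C A∈F B∈G C∈H =
  subst (λ s → t ℕ.≤ ∣ s ∷ (A ∩ B ∩ C) ∣) abc≡f (cross (a ∷ A) (b ∷ B) (c ∷ C) A∈F B∈G C∈H)

-- Three families are needed because the induction passes to links at bits that may differ.
shift-cross : ∀ {n} {F G H : Family n} k → CrossIntersecting 1 F G H →
  CrossIntersecting 1 (shift k F) (shift k G) (shift k H)
shift-cross zero h [] [] [] = h [] [] []
shift-cross zero h (a ∷ []) (b ∷ []) (c ∷ []) = h (a ∷ []) (b ∷ []) (c ∷ [])
-- If the tails do not meet, every intersection has to occur in the first two positions, which is
-- `CrossBits`.
shift-cross {F = F} {G} {H} zero h (a ∷ b ∷ A) (c ∷ d ∷ B) (e ∷ f ∷ C) A∈ B∈ C∈ with 1 ℕ.≤? ∣ A ∩ B ∩ C ∣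
... | yes 0<∣A∩B∩C∣ = ℕ.≤-trans 0<∣A∩B∩C∣
      (ℕ.≤-trans (∣p∣≤∣x∷p∣ (b ∧ d ∧ f) (A ∩ B ∩ C)) (∣p∣≤∣x∷p∣ (a ∧ c ∧ e) ((b ∧ d ∧ f) ∷ (A ∩ B ∩ C))))
... | no 0≮∣A∩B∩C∣ = fromBits (a ∧ c ∧ e) (b ∧ d ∧ f)
      (shift-crossBits {λ a b → F (a ∷ b ∷ A)} {λ a b → G (a ∷ b ∷ B)} {λ a b → H (a ∷ b ∷ C)}
        (λ {a} {b} {c} {d} {e} {f} A∈F B∈G C∈H → toBits (a ∧ c ∧ e) (b ∧ d ∧ f) (h (a ∷ b ∷ A) (c ∷ d ∷ B) (e ∷ f ∷ C) A∈F B∈G C∈H))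
        {a} {b} {c} {d} {e} {f} A∈ B∈ C∈)
  where
  fromBits : ∀ s t → T (s ∨ t) → 1 ℕ.≤ ∣ s ∷ t ∷ (A ∩ B ∩ C) ∣
  fromBits true  t _ = s≤s z≤n
  fromBits false true _ = s≤s z≤n
  toBits : ∀ s t → 1 ℕ.≤ ∣ s ∷ t ∷ (A ∩ B ∩ C) ∣ → T (s ∨ t)
  toBits true  t _ = tt
  toBits false true _ = tt
  toBits false false 0<∣A∩B∩C∣ = contradiction 0<∣A∩B∩C∣ 0≮∣A∩B∩C∣
shift-cross (suc k) h [] [] [] = h [] [] []
shift-cross (suc k) h (a ∷ A) (b ∷ B) (c ∷ C) A∈ B∈ C∈ with a ∧ b ∧ c in abc
... | true = s≤s z≤n
... | false = shift-cross k (link-cross a b c abc h) A B C A∈ B∈ C∈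

-- Elements common to all members of a given size

Pinned : ℕ → Family n → Fin n → Set
Pinned c F x = ∀ {A} → A ∈ᶠ F → ∣ A ∣ ≡ c → x ∈ A

-- The element that is common after the shift at `k` if `x` was common before: `k + 1` moves to `k`,
-- all others stay.
pin : ℕ → Fin n → Fin n
pin zero    (suc zero) = zero
pin zero    x          = x
pin (suc k) zero       = zero
pin (suc k) (suc x)    = suc (pin k x)

shift⁻ : ∀ {n} (F : Family n) k {A} → A ∈ᶠ shift k F → ∃[ B ] B ∈ᶠ F × ∣ B ∣ ≡ ∣ A ∣
shift⁻ F zero {[]} A∈ = _ , A∈ , refl
shift⁻ F zero {_ ∷ []} A∈ = _ , A∈ , refl
shift⁻ F zero {true ∷ true ∷ A} A∈ = _ , A∈ , refl
shift⁻ F zero {true ∷ false ∷ A} A∈ = [ (λ h → _ , h , refl) , (λ h → _ , h , refl) ]′ (T-∨⁻ A∈)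
shift⁻ F zero {false ∷ true ∷ A} A∈ = _ , proj₁ (T-∧⁻ A∈) , refl
shift⁻ F zero {false ∷ false ∷ A} A∈ = _ , A∈ , refl
shift⁻ F (suc k) {[]} A∈ = _ , A∈ , refl
shift⁻ F (suc k) {true ∷ A} A∈ = let _ , B∈F , eq = shift⁻ (link true F) k A∈ in _ , B∈F , cong suc eq
shift⁻ F (suc k) {false ∷ A} A∈ = let _ , B∈F , eq = shift⁻ (link false F) k A∈ in _ , B∈F , eq

shift-pinned : ∀ {n c} {F : Family n} {x} k → Pinned c F x → Pinned c (shift k F) (pin k x)
shift-pinned {n = suc zero} {x = zero} zero h {_ ∷ []} = h
shift-pinned {x = zero} zero h {true ∷ b ∷ A} A∈ eq = here
shift-pinned {x = zero} zero h {false ∷ true ∷ A} A∈ eq = case h (proj₁ (T-∧⁻ A∈)) eq of λ ()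
shift-pinned {x = zero} zero h {false ∷ false ∷ A} A∈ eq = case h A∈ eq of λ ()
shift-pinned {x = suc zero} zero h {true ∷ b ∷ A} A∈ eq = here
shift-pinned {x = suc zero} zero h {false ∷ true ∷ A} A∈ eq = case h (proj₂ (T-∧⁻ A∈)) eq of λ { (there ()) }
shift-pinned {x = suc zero} zero h {false ∷ false ∷ A} A∈ eq = case h A∈ eq of λ { (there ()) }
shift-pinned {x = suc (suc x)} zero h {true ∷ true ∷ A} A∈ eq = h A∈ eq
shift-pinned {x = suc (suc x)} zero h {true ∷ false ∷ A} A∈ eq =
  [ (λ A∈F → h A∈F eq) , (λ A∈F → there (there (drop-there (drop-there (h A∈F eq))))) ]′ (T-∨⁻ A∈)
shift-pinned {x = suc (suc x)} zero h {false ∷ true ∷ A} A∈ eq = h (proj₁ (T-∧⁻ A∈)) eq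
shift-pinned {x = suc (suc x)} zero h {false ∷ false ∷ A} A∈ eq = h A∈ eq
shift-pinned {x = zero} (suc k) h {true ∷ A} A∈ eq = here
shift-pinned {F = F} {x = zero} (suc k) h {false ∷ A} A∈ eq =
  let _ , B∈F , eq′ = shift⁻ (link false F) k A∈ in case h B∈F (trans eq′ eq) of λ ()
shift-pinned {x = suc x} (suc k) h {true ∷ A} A∈ refl =
  there (shift-pinned k (λ B∈F eq → drop-there (h B∈F (cong suc eq))) A∈ refl)
shift-pinned {x = suc x} (suc k) h {false ∷ A} A∈ refl =
  there (shift-pinned k (λ B∈F eq → drop-there (h B∈F eq)) A∈ refl)

-- Termination of repeated shifting

-- An entry outside weighs more the further it is to the left, so adjacent shifts decrease Ψ.
Ψ : Family n → ℕ
Ψ {zero}  F = if F [] then 1 else 0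
Ψ {suc n} F = Ψ (link inside F) ℕ.+ suc n ℕ.* Ψ (link outside F)

Ψ-mono : F ⊑ G → Ψ F ℕ.≤ Ψ G
Ψ-mono {zero} {F} {G} F⊑G with F [] | G [] | F⊑G []
... | true  | true  | _ = ℕ.≤-refl
... | true  | false | h = ⊥-elim (h tt)
... | false | _     | _ = z≤n
Ψ-mono {suc n} F⊑G = ℕ.+-mono-≤ (Ψ-mono λ A → F⊑G (inside ∷ A)) (ℕ.*-monoʳ-≤ (suc n) (Ψ-mono λ A → F⊑G (outside ∷ A)))

Ψ-strict : F ⊑ G → ∀ A → A ∈ᶠ G → ¬ A ∈ᶠ F → Ψ F ℕ.< Ψ G
Ψ-strict {F = F} {G} F⊑G [] A∈G A∉F with F [] | G []
... | true  | _    = ⊥-elim (A∉F tt)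
... | false | true = s≤s z≤n
Ψ-strict {suc n} F⊑G (inside ∷ A) A∈G A∉F =
  ℕ.+-mono-<-≤ (Ψ-strict (λ A → F⊑G (inside ∷ A)) A A∈G A∉F) (ℕ.*-monoʳ-≤ (suc n) (Ψ-mono λ A → F⊑G (outside ∷ A)))
Ψ-strict {suc n} F⊑G (outside ∷ A) A∈G A∉F =
  ℕ.+-mono-≤-< (Ψ-mono λ A → F⊑G (inside ∷ A)) (ℕ.*-monoʳ-< (suc n) (Ψ-strict (λ A → F⊑G (outside ∷ A)) A A∈G A∉F))

Ψ-modular : (F G : Family n) → Ψ (F ∩ᶠ G) ℕ.+ Ψ (F ∪ᶠ G) ≡ Ψ F ℕ.+ Ψ G
Ψ-modular {zero} F G with F [] | G []
... | true  | true  = refl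
... | true  | false = refl
... | false | true  = refl
... | false | false = refl
Ψ-modular {suc n} F G = begin
  (a ℕ.+ m ℕ.* b) ℕ.+ (c ℕ.+ m ℕ.* d)   ≡⟨ regroup m a b c d ⟩
  (a ℕ.+ c) ℕ.+ m ℕ.* (b ℕ.+ d)         ≡⟨ cong₂ (λ x y → x ℕ.+ m ℕ.* y)
                                             (Ψ-modular (link inside F) (link inside G))
                                             (Ψ-modular (link outside F) (link outside G)) ⟩
  (a′ ℕ.+ c′) ℕ.+ m ℕ.* (b′ ℕ.+ d′)     ≡⟨ sym (regroup m a′ b′ c′ d′) ⟩
  (a′ ℕ.+ m ℕ.* b′) ℕ.+ (c′ ℕ.+ m ℕ.* d′) ∎
  where
  open ≡-Reasoning
  m = suc n
  a = Ψ (link inside F ∩ᶠ link inside G)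
  b = Ψ (link outside F ∩ᶠ link outside G)
  c = Ψ (link inside F ∪ᶠ link inside G)
  d = Ψ (link outside F ∪ᶠ link outside G)
  a′ = Ψ (link inside F)
  b′ = Ψ (link outside F)
  c′ = Ψ (link inside G)
  d′ = Ψ (link outside G)
  regroup : ∀ m a b c d → (a ℕ.+ m ℕ.* b) ℕ.+ (c ℕ.+ m ℕ.* d) ≡ (a ℕ.+ c) ℕ.+ m ℕ.* (b ℕ.+ d)
  regroup = solve-∀

-- The shift moves Ψ (oi ∖ io) from weight n + 2 to weight n + 1; both sides are arranged so that no
-- subtraction occurs.
shift-Ψ₀ : (F : Family (suc (suc n))) →
  Ψ (shift 0 F) ℕ.+ Ψ (link inside (link outside F))
  ≡ Ψ F ℕ.+ Ψ (link inside (link outside F) ∩ᶠ link outside (link inside F))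
shift-Ψ₀ {n} F = begin
  (a ℕ.+ m ℕ.* b′) ℕ.+ suc m ℕ.* (c′ ℕ.+ m ℕ.* d) ℕ.+ c  ≡⟨ regroup m a b′ c′ d c ⟩
  m ℕ.* (c′ ℕ.+ b′) ℕ.+ rest                              ≡⟨ cong (λ s → m ℕ.* s ℕ.+ rest) c′+b′≡c+b ⟩
  m ℕ.* (c ℕ.+ b) ℕ.+ rest                                ≡⟨ regroup′ m a b c d c′ ⟩
  (a ℕ.+ m ℕ.* b) ℕ.+ suc m ℕ.* (c ℕ.+ m ℕ.* d) ℕ.+ c′    ∎
  where
  open ≡-Reasoning
  m = suc n
  io = link outside (link inside F)
  oi = link inside (link outside F)
  a = Ψ (link inside (link inside F))
  b = Ψ io
  c = Ψ oi
  d = Ψ (link outside (link outside F))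
  b′ = Ψ (io ∪ᶠ oi)
  c′ = Ψ (oi ∩ᶠ io)
  rest = a ℕ.+ suc m ℕ.* (m ℕ.* d) ℕ.+ c ℕ.+ c′
  ∪-comm-≤ : (F G : Family n) → F ∪ᶠ G ⊑ G ∪ᶠ F
  ∪-comm-≤ F G A = subst T (∨-comm (F A) (G A))
  c′+b′≡c+b : c′ ℕ.+ b′ ≡ c ℕ.+ b
  c′+b′≡c+b = trans (cong (c′ ℕ.+_) (ℕ.≤-antisym (Ψ-mono (∪-comm-≤ io oi)) (Ψ-mono (∪-comm-≤ oi io))))
                    (Ψ-modular oi io)
  regroup : ∀ m a b c d e → (a ℕ.+ m ℕ.* b) ℕ.+ suc m ℕ.* (c ℕ.+ m ℕ.* d) ℕ.+ e
          ≡ m ℕ.* (c ℕ.+ b) ℕ.+ (a ℕ.+ suc m ℕ.* (m ℕ.* d) ℕ.+ e ℕ.+ c)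
  regroup = solve-∀
  regroup′ : ∀ m a b c d e → m ℕ.* (c ℕ.+ b) ℕ.+ (a ℕ.+ suc m ℕ.* (m ℕ.* d) ℕ.+ c ℕ.+ e)
           ≡ (a ℕ.+ m ℕ.* b) ℕ.+ suc m ℕ.* (c ℕ.+ m ℕ.* d) ℕ.+ e
  regroup′ = solve-∀

shift-Ψ≤ : ∀ {n} k (F : Family n) → Ψ (shift k F) ℕ.≤ Ψ F
shift-Ψ≤ {zero} zero F = ℕ.≤-refl
shift-Ψ≤ {zero} (suc k) F = ℕ.≤-refl
shift-Ψ≤ {suc zero} zero F = ℕ.≤-refl
shift-Ψ≤ {suc (suc n)} zero F = ℕ.+-cancelʳ-≤ _ _ _
  (ℕ.≤-trans (ℕ.≤-reflexive (shift-Ψ₀ F)) (ℕ.+-monoʳ-≤ (Ψ F)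
    (Ψ-mono {F = link inside (link outside F) ∩ᶠ link outside (link inside F)} λ A → proj₁ ∘ T-∧⁻)))
shift-Ψ≤ {suc n} (suc k) F =
  ℕ.+-mono-≤ (shift-Ψ≤ k (link inside F)) (ℕ.*-monoʳ-≤ (suc n) (shift-Ψ≤ k (link outside F)))

-- A failure of `Adjacent` is a set that lies in the link at `outside`, `inside` but not in the one
-- at `inside`, `outside`; by `shift-Ψ₀` the shift there lowers `Ψ`.
shifted? : ∀ {n} (F : Family n) → Shifted F ⊎ ∃[ k ] Ψ (shift k F) ℕ.< Ψ F
shifted? {zero} F = inj₁ nil
shifted? {suc n} F with shifted? (link inside F) | shifted? (link outside F)
... | inj₂ (k , <₁) | _ = inj₂ (suc k , ℕ.+-mono-<-≤ <₁ (ℕ.*-monoʳ-≤ (suc n) (shift-Ψ≤ k (link outside F))))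
... | inj₁ s₁ | inj₂ (k , <₀) = inj₂ (suc k , ℕ.+-mono-≤-< (shift-Ψ≤ k (link inside F)) (ℕ.*-monoʳ-< (suc n) <₀))
shifted? {suc zero} F | inj₁ s₁ | inj₁ s₀ = inj₁ (cons s₁ s₀ tt)
shifted? {suc (suc n)} F | inj₁ s₁ | inj₁ s₀
  with anySubset? (λ A → T? (F (outside ∷ inside ∷ A)) ×-dec ¬? (T? (F (inside ∷ outside ∷ A))))
... | no ∄A = inj₁ (cons s₁ s₀ λ A A∈F → decidable-stable (T? _) λ A∉F → ∄A (A , A∈F , A∉F))
... | yes (A , A∈F , A∉F) = inj₂ (0 , ℕ.+-cancelʳ-< _ _ _
  (ℕ.≤-<-trans (ℕ.≤-reflexive (shift-Ψ₀ F))
    (ℕ.+-monoʳ-< (Ψ F) (Ψ-strict {F = link inside (link outside F) ∩ᶠ link outside (link inside F)}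
      (λ A → proj₁ ∘ T-∧⁻) A A∈F (A∉F ∘ proj₂ ∘ T-∧⁻)))))

------------------------------------------------------------------------
-- Intersection sizes in links of shifted families

∩-swap : ∀ (A B C : Subset n) → A ∩ B ∩ C ≡ B ∩ A ∩ C
∩-swap A B C = trans (sym (∩-assoc A B C)) (trans (cong (_∩ C) (∩-comm A B)) (∩-assoc B A C))

link-in-2-wise : ∀ {t} {F : Family (suc n)} → 2-Wise (suc t) F → 2-Wise t (link inside F)
link-in-2-wise w A B A∈F B∈F = s≤s⁻¹ (w _ _ A∈F B∈F)

-- Exchanging a common element of `A` and `B` out of `A` removes it from the intersection, and the
-- new first element is not in the second set. So the original intersection had one element more.
link-out-2-wise : ∀ {t} {F : Family (suc n)} → Shifted F → 2-Wise (suc t) F → 2-Wise (suc (suc t)) (link outside F)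
link-out-2-wise sh w A B A∈F B∈F =
  let x , x∈A , _ , eq = common A B (ℕ.≤-trans (s≤s z≤n) (w _ _ A∈F B∈F))
  in subst (_ ℕ.≤_) (sym eq) (s≤s (w _ _ (exchange sh x∈A A∈F) B∈F))

link-in-3-wise : ∀ {t} {F : Family (suc n)} → 3-Wise (suc t) F → 3-Wise t (link inside F)
link-in-3-wise w A B C A∈F B∈F C∈F = s≤s⁻¹ (w _ _ _ A∈F B∈F C∈F)

-- One common element is exchanged out of `A` and another out of `B`; the third set still lacks the
-- first element, so the intersection has lost two.
link-out-3-wise : ∀ {t} {F : Family (suc n)} → Shifted F → 3-Wise (suc t) F → 3-Wise (3 ℕ.+ t) (link outside F)
link-out-3-wise {t = t} sh w A B C A∈F B∈F C∈F =
  let x , x∈A , _ , eq = common A (B ∩ C) (ℕ.≤-trans (s≤s z≤n) (w _ _ _ A∈F B∈F C∈F))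
      A-x∈F = exchange sh x∈A A∈F
      swap = cong ∣_∣ (∩-swap (A - x) B C)
      y , y∈B , _ , eq′ = common B ((A - x) ∩ C)
        (subst (0 ℕ.<_) swap (ℕ.≤-trans (s≤s z≤n) (w _ _ _ A-x∈F B∈F C∈F)))
  in subst (3 ℕ.+ t ℕ.≤_) (sym (trans eq (cong suc (trans swap eq′))))
       (s≤s (s≤s (w _ _ _ (exchange sh y∈B B∈F) A-x∈F C∈F)))

2-wise-weaken : ∀ {s t} {F : Family n} → s ℕ.≤ t → 2-Wise t F → 2-Wise s F
2-wise-weaken s≤t w A B A∈F B∈F = ℕ.≤-trans s≤t (w A B A∈F B∈F)

-- A spread 3-wise intersecting family cannot have A ∩ B = {x}, since ⊤ - x is a member.
3-wise⇒2-wise : {F : Family n} → Spread F → 3-Wise 1 F → 2-Wise 2 F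
3-wise⇒2-wise {F = F} sp w A B A∈F B∈F =
  let x , _ , _ , eq = common A B
        (ℕ.≤-trans (w A B B A∈F B∈F B∈F) (ℕ.≤-reflexive (cong (λ C → ∣ A ∩ C ∣) (∩-idem B))))
      [A-x]∩B≡A∩B∩[⊤-x] = trans (sym (∩-- A B x)) (trans (cong (_- x) (sym (∩-identityˡ (A ∩ B))))
        (trans (∩-- ⊤ (A ∩ B) x) (trans (∩-comm (⊤ - x) (A ∩ B)) (∩-assoc A B (⊤ - x)))))
  in subst (2 ℕ.≤_) (sym eq) (s≤s (subst (1 ℕ.≤_) (cong ∣_∣ (sym [A-x]∩B≡A∩B∩[⊤-x]))
       (w A B (⊤ - x) A∈F B∈F (spread⇒⊤-x sp x))))

-- A set `C` that misses 1 and 2 can trade an element for 2, and the first set, which contains 1,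
-- can do so as well. The second set contains only 1 of the two, so neither 1 nor 2 is common, and
-- `A ∩ B ∩ C` had three elements.
link-in-out-2-wise : {F : Family (suc (suc n))} → Shifted F → 3-Wise 1 F →
  Inhabited (link outside (link outside F)) → 2-Wise 3 (link outside (link inside F))
link-in-out-2-wise (cons s₁ s₀ _) w (C , C∈F) A B A∈F B∈F =
  let x , x∈C , _ , eq = common C (A ∩ B)
        (subst (λ D → 0 ℕ.< ∣ D ∣) (trans (cong (A ∩_) (∩-comm B C)) (∩-swap A C B)) (w _ _ _ A∈F B∈F C∈F))
      C-x∈F = exchange s₀ x∈C C∈F
      y , y∈A , _ , eq′ = common A ((C - x) ∩ B)
        (subst (λ D → 0 ℕ.< ∣ D ∣) (cong (A ∩_) (∩-comm B (C - x))) (w _ _ _ A∈F B∈F C-x∈F))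
  in ℕ.≤-trans
       (subst (3 ℕ.≤_) (sym (trans eq (cong suc (trans (cong ∣_∣ (∩-swap (C - x) A B)) eq′))))
         (s≤s (s≤s (subst (λ D → 1 ℕ.≤ ∣ (A - y) ∩ D ∣) (∩-comm B (C - x))
           (w _ _ _ (exchange s₁ y∈A A∈F) B∈F C-x∈F)))))
       (∣p∩q∣≤∣q∣ C (A ∩ B))

-- A member of the smaller family of least size loses an element by an exchange.
link-out-out-strict : {F : Family (suc (suc n))} → Shifted F → 3-Wise 1 F → ∀ k A → ∣ A ∣ ℕ.≤ k →
  A ∈ᶠ link outside (link outside F) →
  ∃[ B ] B ∈ᶠ link outside (link inside F) × ¬ B ∈ᶠ link outside (link outside F)
link-out-out-strict {F = F} sh@(cons _ s₀ adj) w k A ∣A∣≤k A∈F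
  with 0<∣∣⇒Nonempty {A = A} (subst (λ B → 1 ℕ.≤ ∣ B ∣) (trans (cong (A ∩_) (∩-idem A)) (∩-idem A))
         (w _ _ _ A∈F A∈F A∈F))
... | x , x∈A with T? (F (outside ∷ outside ∷ (A - x)))
... | no A-x∉ = A - x , adj _ (exchange s₀ x∈A A∈F) , A-x∉
link-out-out-strict sh w zero A ∣A∣≤k A∈F | x , x∈A | yes A-x∈
  with () ← subst (ℕ._≤ 0) (∣p∣≡1+∣p-x∣ x∈A) ∣A∣≤k
link-out-out-strict sh w (suc k) A ∣A∣≤k A∈F | x , x∈A | yes A-x∈ =
  link-out-out-strict sh w k (A - x) (s≤s⁻¹ (subst (ℕ._≤ suc k) (∣p∣≡1+∣p-x∣ x∈A) ∣A∣≤k)) A-x∈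

------------------------------------------------------------------------
-- Product measures

≤-by : ∀ {x y z} → 0ℚ ℚ.≤ z → y ≡ x ℚ.+ z → x ℚ.≤ y
≤-by {x} {y} {z} 0≤z eq = subst₂ ℚ._≤_ (ℚ.+-identityʳ x) (sym eq) (ℚ.+-monoʳ-≤ x 0≤z)

0≤- : ∀ {x y} → x ℚ.≤ y → 0ℚ ℚ.≤ y ℚ.- x
0≤- {x} {y} x≤y = subst (ℚ._≤ y ℚ.- x) (ℚ.+-inverseʳ x) (ℚ.+-monoˡ-≤ (ℚ.- x) x≤y)

infixl 6 _0≤+_
infixl 7 _0≤*_

_0≤+_ : ∀ {x y} → 0ℚ ℚ.≤ x → 0ℚ ℚ.≤ y → 0ℚ ℚ.≤ x ℚ.+ y
_0≤+_ = ℚ.+-mono-≤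

_0≤*_ : ∀ {x y} → 0ℚ ℚ.≤ x → 0ℚ ℚ.≤ y → 0ℚ ℚ.≤ x ℚ.* y
_0≤*_ {x} {y} 0≤x 0≤y = ℚ.nonNegative⁻¹ (x ℚ.* y)
  {{ℚ.nonNeg*nonNeg⇒nonNeg x {{ℚ.nonNegative 0≤x}} y {{ℚ.nonNegative 0≤y}}}}

0≤^ : ∀ {x} → 0ℚ ℚ.≤ x → ∀ k → 0ℚ ℚ.≤ x ^ k
0≤^ 0≤x zero    = from-yes (0ℚ ℚ.≤? 1ℚ)
0≤^ 0≤x (suc k) = 0≤x 0≤* 0≤^ 0≤x k

*-mono-≤ : ∀ {x y z w} → 0ℚ ℚ.≤ x → 0ℚ ℚ.≤ w → x ℚ.≤ y → z ℚ.≤ w → x ℚ.* z ℚ.≤ y ℚ.* w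
*-mono-≤ {x} {y} {z} {w} 0≤x 0≤w x≤y z≤w = ℚ.≤-trans
  (ℚ.*-monoˡ-≤-nonNeg x {{ℚ.nonNegative 0≤x}} z≤w) (ℚ.*-monoʳ-≤-nonNeg w {{ℚ.nonNegative 0≤w}} x≤y)

-- M p (1 − p) is μ p; M (1 − p) p occurs as the measure of families of complements.
M : ℚ → ℚ → Family n → ℚ
M {zero}  a b F = if F [] then 1ℚ else 0ℚ
M {suc n} a b F = a ℚ.* M a b (link inside F) ℚ.+ b ℚ.* M a b (link outside F)

module _ {a b : ℚ} where

  M-empty : (F : Family n) → ¬ Inhabited F → M a b F ≡ 0ℚ
  M-empty {zero} F ∄ with F [] in eq
  ... | true  = ⊥-elim (∄ ([] , subst T (sym eq) tt))
  ... | false = refl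
  M-empty {suc n} F ∄ = trans
    (cong₂ (λ x y → a ℚ.* x ℚ.+ b ℚ.* y)
      (M-empty (link inside F) (λ (A , A∈F) → ∄ (_ , A∈F)))
      (M-empty (link outside F) (λ (A , A∈F) → ∄ (_ , A∈F))))
    (cong₂ ℚ._+_ (ℚ.*-zeroʳ a) (ℚ.*-zeroʳ b))

  M-modular : (F G : Family n) → M a b (F ∩ᶠ G) ℚ.+ M a b (F ∪ᶠ G) ≡ M a b F ℚ.+ M a b G
  M-modular {zero} F G with F [] | G []
  ... | true  | true  = refl
  ... | true  | false = refl
  ... | false | true  = refl
  ... | false | false = refl
  M-modular {suc n} F G = trans (regroup a b _ _ _ _) (trans
    (cong₂ (λ x y → a ℚ.* x ℚ.+ b ℚ.* y)
      (M-modular (link inside F) (link inside G)) (M-modular (link outside F) (link outside G)))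
    (sym (regroup a b _ _ _ _)))
    where
    regroup : ∀ a b x y z w → (a ℚ.* x ℚ.+ b ℚ.* y) ℚ.+ (a ℚ.* z ℚ.+ b ℚ.* w)
            ≡ a ℚ.* (x ℚ.+ z) ℚ.+ b ℚ.* (y ℚ.+ w)
    regroup = solve 6 (λ a b x y z w → (a :* x :+ b :* y) :+ (a :* z :+ b :* w)
            := a :* (x :+ z) :+ b :* (y :+ w)) refl

  M-cong : (F G : Family n) → (∀ A → F A ≡ G A) → M a b F ≡ M a b G
  M-cong {zero} F G F≗G = cong (λ x → if x then 1ℚ else 0ℚ) (F≗G [])
  M-cong {suc n} F G F≗G = cong₂ (λ x y → a ℚ.* x ℚ.+ b ℚ.* y)
    (M-cong _ _ (λ A → F≗G (inside ∷ A))) (M-cong _ _ (λ A → F≗G (outside ∷ A)))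

  -- The two links that a shift changes carry the same weight `a b`, and it replaces them by their
  -- union and intersection.
  M-shift : ∀ k (F : Family n) → M a b (shift k F) ≡ M a b F
  M-shift {zero} zero F = refl
  M-shift {zero} (suc k) F = refl
  M-shift {suc zero} zero F = refl
  M-shift {suc (suc n)} zero F = trans (regroup a b _ _ _ _)
    (trans (cong (λ x → a ℚ.* b ℚ.* x ℚ.+ (a ℚ.* a ℚ.* M a b ii ℚ.+ b ℚ.* b ℚ.* M a b oo))
      (trans (cong (ℚ._+ M a b (oi ∩ᶠ io)) (M-cong (io ∪ᶠ oi) (oi ∪ᶠ io) (λ A → ∨-comm (io A) (oi A))))
        (trans (ℚ.+-comm (M a b (oi ∪ᶠ io)) (M a b (oi ∩ᶠ io)))
          (trans (M-modular oi io) (ℚ.+-comm (M a b oi) (M a b io))))))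
    (sym (regroup a b _ _ _ _)))
    where
    ii = link inside (link inside F)
    io = link outside (link inside F)
    oi = link inside (link outside F)
    oo = link outside (link outside F)
    regroup : ∀ a b x y z w → a ℚ.* (a ℚ.* x ℚ.+ b ℚ.* y) ℚ.+ b ℚ.* (a ℚ.* z ℚ.+ b ℚ.* w)
            ≡ a ℚ.* b ℚ.* (y ℚ.+ z) ℚ.+ (a ℚ.* a ℚ.* x ℚ.+ b ℚ.* b ℚ.* w)
    regroup = solve 6 (λ a b x y z w → a :* (a :* x :+ b :* y) :+ b :* (a :* z :+ b :* w)
            := a :* b :* (y :+ z) :+ (a :* a :* x :+ b :* b :* w)) refl
  M-shift {suc n} (suc k) F = cong₂ (λ x y → a ℚ.* x ℚ.+ b ℚ.* y)
    (M-shift k (link inside F)) (M-shift k (link outside F))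

module _ {a b : ℚ} (0≤a : 0ℚ ℚ.≤ a) (0≤b : 0ℚ ℚ.≤ b) where

  M-mono : ∀ {n} {F G : Family n} → F ⊑ G → M a b F ℚ.≤ M a b G
  M-mono {zero} {F} {G} F⊑G with F [] | G [] | F⊑G []
  ... | true  | true  | _ = ℚ.≤-refl
  ... | true  | false | h = ⊥-elim (h tt)
  ... | false | true  | _ = from-yes (0ℚ ℚ.≤? 1ℚ)
  ... | false | false | _ = ℚ.≤-refl
  M-mono {suc n} F⊑G = ℚ.+-mono-≤
    (ℚ.*-monoˡ-≤-nonNeg a {{ℚ.nonNegative 0≤a}} (M-mono λ A → F⊑G (inside ∷ A)))
    (ℚ.*-monoˡ-≤-nonNeg b {{ℚ.nonNegative 0≤b}} (M-mono λ A → F⊑G (outside ∷ A)))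

  0≤M : ∀ {n} (F : Family n) → 0ℚ ℚ.≤ M a b F
  0≤M {n} F = subst (ℚ._≤ M a b F) (M-empty {a} {b} {n} (λ _ → false) λ ()) (M-mono {F = λ _ → false} {F} λ _ ())

  module _ {δ : ℚ} (0≤δ : 0ℚ ℚ.≤ δ) (δ≤a : δ ℚ.≤ a) (δ≤b : δ ℚ.≤ b) where

    -- `δ ^ n` bounds the weight of the single set `A` from below.
    M-strict : ∀ {n} {F G : Family n} → F ⊑ G → ∀ A → A ∈ᶠ G → ¬ A ∈ᶠ F → M a b F ℚ.+ δ ^ n ℚ.≤ M a b G
    M-strict {F = F} {G} F⊑G [] A∈G A∉F with F [] | G []
    ... | true  | _    = ⊥-elim (A∉F tt)
    ... | false | true = ℚ.≤-refl
    M-strict {suc n} {F} {G} F⊑G (inside ∷ A) A∈G A∉F =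
      ≤-by (0≤a 0≤* 0≤- (M-strict {F = link inside F} {link inside G} (λ A → F⊑G (inside ∷ A)) A A∈G A∉F)
            0≤+ 0≤b 0≤* 0≤- (M-mono {F = link outside F} {link outside G} λ A → F⊑G (outside ∷ A))
            0≤+ 0≤- δ≤a 0≤* 0≤^ 0≤δ n)
        (solve 8 (λ a b x y z w δ e → a :* x :+ b :* y := (a :* z :+ b :* w :+ δ :* e) :+
           (a :* (x :- (z :+ e)) :+ b :* (y :- w) :+ (a :- δ) :* e)) refl a b _ _ _ _ δ (δ ^ n))
    M-strict {suc n} {F} {G} F⊑G (outside ∷ A) A∈G A∉F =
      ≤-by (0≤b 0≤* 0≤- (M-strict {F = link outside F} {link outside G} (λ A → F⊑G (outside ∷ A)) A A∈G A∉F)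
            0≤+ 0≤a 0≤* 0≤- (M-mono {F = link inside F} {link inside G} λ A → F⊑G (inside ∷ A))
            0≤+ 0≤- δ≤b 0≤* 0≤^ 0≤δ n)
        (solve 8 (λ a b x y z w δ e → a :* x :+ b :* y := (a :* z :+ b :* w :+ δ :* e) :+
           (b :* (y :- (w :+ e)) :+ a :* (x :- z) :+ (b :- δ) :* e)) refl a b _ _ _ _ δ (δ ^ n))

------------------------------------------------------------------------
-- Intersecting families

-- The complements of the members of `G` form a family disjoint from `F`, and `M q p G` is its
-- measure for the weights `p`, `q`.
M-dual : ∀ {p q} → 0ℚ ℚ.≤ p → 0ℚ ℚ.≤ q → p ℚ.+ q ≡ 1ℚ → (F G : Family n) →
  (∀ A B → A ∈ᶠ F → B ∈ᶠ G → 1 ℕ.≤ ∣ A ∩ B ∣) → M p q F ℚ.+ M q p G ℚ.≤ 1ℚ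
M-dual {zero} 0≤p 0≤q p+q≡1 F G cross with F [] in F∋ | G [] in G∋
... | true  | true  = case cross [] [] (subst T (sym F∋) tt) (subst T (sym G∋) tt) of λ ()
... | true  | false = ℚ.≤-refl
... | false | true  = ℚ.≤-refl
... | false | false = from-yes (0ℚ ℚ.≤? 1ℚ)
M-dual {suc n} {p} {q} 0≤p 0≤q p+q≡1 F G cross =
  ≤-by (0≤p 0≤* 0≤- (M-dual 0≤p 0≤q p+q≡1 (link inside F) (link outside G) (λ A B → cross _ _))
        0≤+ 0≤q 0≤* 0≤- (M-dual 0≤p 0≤q p+q≡1 (link outside F) (link inside G) (λ A B → cross _ _)))
    (trans (sym p+q≡1) (solve 6 (λ p q x y z w →
      p :+ q := (p :* x :+ q :* y) :+ (q :* z :+ p :* w) :+ (p :* (con 1ℚ :- (x :+ w)) :+ q :* (con 1ℚ :- (y :+ z))))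
      refl p q (M p q (link inside F)) (M p q (link outside F)) (M q p (link inside G)) (M q p (link outside G))))

M≤1 : ∀ {p q} → 0ℚ ℚ.≤ p → 0ℚ ℚ.≤ q → p ℚ.+ q ≡ 1ℚ → (F : Family n) → M p q F ℚ.≤ 1ℚ
M≤1 {n} {p} {q} 0≤p 0≤q p+q≡1 F = subst (ℚ._≤ 1ℚ)
  (trans (cong (M p q F ℚ.+_) (M-empty {q} {p} {n} (λ _ → false) λ ())) (ℚ.+-identityʳ _))
  (M-dual 0≤p 0≤q p+q≡1 F (λ _ → false) λ _ _ _ ())

p+[1-p]≡1 : ∀ p → p ℚ.+ (1ℚ ℚ.- p) ≡ 1ℚ
p+[1-p]≡1 = solve 1 (λ p → p :+ (con 1ℚ :- p) := con 1ℚ) refl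

initial : ∀ n → ℕ → Subset n
initial zero    t       = []
initial (suc n) zero    = outside ∷ initial n zero
initial (suc n) (suc t) = inside ∷ initial n t

initial-zero : ∀ n → initial n 0 ≡ ∅
initial-zero zero    = refl
initial-zero (suc n) = cong (outside ∷_) (initial-zero n)

module _ {p q : ℚ} (0≤p : 0ℚ ℚ.≤ p) (p≤q : p ℚ.≤ q) where

  private
    0≤q : 0ℚ ℚ.≤ q
    0≤q = ℚ.≤-trans 0≤p p≤q

  -- The exchange of weights moves `q − p` from the outside link to the inside link, which contains
  -- it.
  M-flip₀ : {F : Family n} → UpClosed F → M p q F ℚ.≤ M q p F
  M-flip₀ nil = ℚ.≤-refl
  M-flip₀ {F = F} (cons u₁ u₀ o⊑i) =
    ≤-by (0≤q 0≤* 0≤- (M-flip₀ u₁) 0≤+ 0≤p 0≤* 0≤- (M-flip₀ u₀) 0≤+ 0≤- p≤q 0≤* 0≤- (M-mono 0≤p 0≤q o⊑i))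
      (solve 6 (λ p q x y z w → q :* z :+ p :* w := p :* x :+ q :* y :+
        (q :* (z :- x) :+ p :* (w :- y) :+ (q :- p) :* (x :- y))) refl p q
        (M p q (link inside F)) (M p q (link outside F)) (M q p (link inside F)) (M q p (link outside F)))

  private
    flip-step : ∀ P Q x y z w →
      p ℚ.* P ℚ.* (q ℚ.* z ℚ.+ p ℚ.* w) ≡ q ℚ.* Q ℚ.* (p ℚ.* x ℚ.+ q ℚ.* y) ℚ.+
        (p ℚ.* q ℚ.* (P ℚ.* z ℚ.- Q ℚ.* x) ℚ.+ (p ℚ.* (p ℚ.* P) ℚ.* w ℚ.- q ℚ.* (q ℚ.* Q) ℚ.* y))
    flip-step = solve 8 (λ p q P Q x y z w →
      p :* P :* (q :* z :+ p :* w) := q :* Q :* (p :* x :+ q :* y) :+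
        (p :* q :* (P :* z :- Q :* x) :+ (p :* (p :* P) :* w :- q :* (q :* Q) :* y))) refl p q

    2-wise⇒∄ : ∀ {t} {F : Family 0} → 2-Wise (suc t) F → ¬ Inhabited F
    2-wise⇒∄ w ([] , h) = case w [] [] h h of λ ()

  -- In the first coordinate the inequality is a combination of those for t − 1 and t + 1.
  M-flip : ∀ t {F : Family n} → UpClosed F → Shifted F → 2-Wise t F → q ^ t ℚ.* M p q F ℚ.≤ p ^ t ℚ.* M q p F
  M-flip zero u _ _ = ℚ.*-monoˡ-≤-nonNeg 1ℚ (M-flip₀ u)
  M-flip (suc t) {F} nil _ w = ℚ.≤-reflexive (trans
    (trans (cong (q ^ suc t ℚ.*_) (M-empty {p} {q} F (2-wise⇒∄ w))) (ℚ.*-zeroʳ (q ^ suc t)))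
    (sym (trans (cong (p ^ suc t ℚ.*_) (M-empty {q} {p} F (2-wise⇒∄ w))) (ℚ.*-zeroʳ (p ^ suc t)))))
  M-flip (suc t) (cons u₁ u₀ _) sh@(cons s₁ s₀ _) w =
    ≤-by (0≤p 0≤* 0≤q 0≤* 0≤- (M-flip t u₁ s₁ (link-in-2-wise w))
          0≤+ 0≤- (M-flip (suc (suc t)) u₀ s₀ (link-out-2-wise sh w)))
      (flip-step (p ^ t) (q ^ t) _ _ _ _)

  module _ {δ} (0≤δ : 0ℚ ℚ.≤ δ) (δ≤1 : δ ℚ.≤ 1ℚ) (δ≤q : δ ℚ.≤ q) (δ≤p : δ ℚ.≤ p) (δ≤pq : δ ℚ.≤ p ℚ.* q) where

    -- Inside links lead first to `t = 0` and then towards the member `⊤`. As the empty set is no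
    -- member, some coordinate on the way has it in the inside link but not in the outside one, and
    -- `M-strict` gives the gap there.
    M-flip-strict : ∀ {n} t {F : Family n} → UpClosed F → Shifted F → 2-Wise t F →
      ⊤ ∈ᶠ F → ¬ initial n t ∈ᶠ F →
      q ^ t ℚ.* M p q F ℚ.+ (q ℚ.- p) ℚ.* δ ^ suc n ℚ.≤ p ^ t ℚ.* M q p F
    M-flip-strict zero nil _ _ ⊤∈F ∉F = contradiction ⊤∈F ∉F
    M-flip-strict (suc t) nil _ _ ⊤∈F ∉F = contradiction ⊤∈F ∉F
    M-flip-strict {suc n} zero {F} (cons u₁ u₀ o⊑i) (cons s₁ s₀ _) w ⊤∈F ∉F with T? (F (inside ∷ initial n 0))
    ... | yes ∈F =
      ≤-by (0≤q 0≤* 0≤- (M-flip₀ u₁) 0≤+ 0≤p 0≤* 0≤- (M-flip₀ u₀)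
            0≤+ 0≤- p≤q 0≤* (0≤- (M-strict 0≤p 0≤q 0≤δ δ≤p δ≤q o⊑i (initial n 0) ∈F ∉F)
              0≤+ (0≤- δ≤1 0≤* (0≤^ 0≤δ n) 0≤+ 0≤δ 0≤* (0≤- δ≤1 0≤* 0≤^ 0≤δ n))))
        (solve 8 (λ p q x y z w δ e → con 1ℚ :* (q :* z :+ p :* w) :=
           con 1ℚ :* (p :* x :+ q :* y) :+ (q :- p) :* (δ :* (δ :* e)) :+
           (q :* (z :- x) :+ p :* (w :- y) :+
            (q :- p) :* ((x :- (y :+ e)) :+ ((con 1ℚ :- δ) :* e :+ δ :* ((con 1ℚ :- δ) :* e))))) refl p q
         (M p q (link inside F)) (M p q (link outside F)) (M q p (link inside F)) (M q p (link outside F)) δ (δ ^ n))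
    ... | no ∉F₁ =
      ≤-by (0≤q 0≤* 0≤- (M-flip-strict zero u₁ s₁ (λ _ _ _ _ → z≤n) ⊤∈F ∉F₁)
            0≤+ 0≤p 0≤* 0≤- (M-flip₀ u₀) 0≤+ 0≤- p≤q 0≤* 0≤- (M-mono 0≤p 0≤q o⊑i)
            0≤+ 0≤- p≤q 0≤* (0≤- δ≤q 0≤* 0≤^ 0≤δ (suc n)))
        (solve 8 (λ p q x y z w δ e → con 1ℚ :* (q :* z :+ p :* w) :=
           con 1ℚ :* (p :* x :+ q :* y) :+ (q :- p) :* (δ :* e) :+
           (q :* (con 1ℚ :* z :- (con 1ℚ :* x :+ (q :- p) :* e)) :+ p :* (w :- y) :+ (q :- p) :* (x :- y) :+
            (q :- p) :* ((q :- δ) :* e))) refl p q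
         (M p q (link inside F)) (M p q (link outside F)) (M q p (link inside F)) (M q p (link outside F)) δ (δ ^ suc n))
    M-flip-strict {suc n} (suc t) {F} (cons u₁ u₀ _) sh@(cons s₁ s₀ _) w ⊤∈F ∉F =
      ≤-by (0≤p 0≤* 0≤q 0≤* 0≤- (M-flip-strict t u₁ s₁ (link-in-2-wise w) ⊤∈F ∉F)
            0≤+ 0≤- (M-flip (suc (suc t)) u₀ s₀ (link-out-2-wise sh w))
            0≤+ 0≤- δ≤pq 0≤* (0≤- p≤q 0≤* 0≤^ 0≤δ (suc n)))
        (solve 10 (λ p q P Q x y z w δ e →
          p :* P :* (q :* z :+ p :* w) := q :* Q :* (p :* x :+ q :* y) :+ (q :- p) :* (δ :* e) :+
            (p :* q :* (P :* z :- (Q :* x :+ (q :- p) :* e)) :+ (p :* (p :* P) :* w :- q :* (q :* Q) :* y) :+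
             (p :* q :- δ) :* ((q :- p) :* e))) refl p q (p ^ t) (q ^ t)
         (M p q (link inside F)) (M p q (link outside F)) (M q p (link inside F)) (M q p (link outside F)) δ (δ ^ suc n))

  -- Let `x`, `y` measure the inside and outside links and `w` the outside one with exchanged
  -- weights. Then `q y ≤ p w` by `M-flip` and `x + w ≤ 1` by `M-dual`.
  M-intersecting : p ℚ.+ q ≡ 1ℚ → {F : Family n} → UpClosed F → Shifted F → 2-Wise 1 F → M p q F ℚ.≤ p
  M-intersecting _ {F} nil _ w = subst (ℚ._≤ p) (sym (M-empty {p} {q} F (2-wise⇒∄ w))) 0≤p
  M-intersecting p+q≡1 {F} (cons u₁ u₀ o⊑i) sh@(cons s₁ s₀ _) w =
    ≤-by (0≤p 0≤* 0≤- (M-dual 0≤p 0≤q p+q≡1 (link inside F) (link outside F) (λ A B → w _ _))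
          0≤+ 0≤- (M-flip 1 u₀ s₀ (2-wise-weaken (ℕ.n≤1+n 1) (link-out-2-wise sh w))))
      (solve 5 (λ p q x y w → p := p :* x :+ q :* y :+
        (p :* (con 1ℚ :- (x :+ w)) :+ (p :* con 1ℚ :* w :- q :* con 1ℚ :* y))) refl p q
        (M p q (link inside F)) (M p q (link outside F)) (M q p (link outside F)))

------------------------------------------------------------------------
-- Measures of shifted families

private
  ⅓ ¼ 1/8 5/4 61/64 : ℚ
  ⅓ = + 1 / 3
  ¼ = + 1 / 4
  1/8 = + 1 / 8
  5/4 = + 5 / 4
  61/64 = + 61 / 64

-- a lower bound for p, q and p q
δ : ℚ
δ = + 1 / 16

0≤δ : 0ℚ ℚ.≤ δ
0≤δ = from-yes (0ℚ ℚ.≤? δ)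

δ≤1 : δ ℚ.≤ 1ℚ
δ≤1 = from-yes (δ ℚ.≤? 1ℚ)

δ^-mono : ∀ {k m} → k ℕ.≤ m → δ ^ m ℚ.≤ δ ^ k
δ^-mono {m = zero} z≤n = ℚ.≤-refl
δ^-mono {m = suc m} z≤n = *-mono-≤ 0≤δ (from-yes (0ℚ ℚ.≤? 1ℚ)) δ≤1 (δ^-mono {m = m} z≤n)
δ^-mono (s≤s k≤m) = ℚ.*-monoˡ-≤-nonNeg δ (δ^-mono k≤m)

⅓≤p⇒δ≤p : ∀ {p} → + 1 / 3 ℚ.≤ p → δ ℚ.≤ p
⅓≤p⇒δ≤p = ℚ.≤-trans (from-yes (δ ℚ.≤? ⅓))

p≤½⇒δ≤q : ∀ {p} → p ℚ.≤ + 1 / 2 → δ ℚ.≤ 1ℚ ℚ.- p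
p≤½⇒δ≤q p≤½ = ℚ.≤-trans (from-yes (δ ℚ.≤? 1ℚ ℚ.- ℚ.½)) (ℚ.+-monoʳ-≤ 1ℚ (ℚ.neg-antimono-≤ p≤½))

module _ {p : ℚ} (⅓≤p : + 1 / 3 ℚ.≤ p) (p≤½ : p ℚ.≤ + 1 / 2) where

  private
    q = 1ℚ ℚ.- p

    0≤p : 0ℚ ℚ.≤ p
    0≤p = ℚ.≤-trans 0≤δ (⅓≤p⇒δ≤p ⅓≤p)
    p≤q : p ℚ.≤ q
    p≤q = ≤-by (0≤- p≤½ 0≤+ 0≤- p≤½)
      (solve 1 (λ p → con 1ℚ :- p := p :+ ((con ℚ.½ :- p) :+ (con ℚ.½ :- p))) refl p)
    0≤q : 0ℚ ℚ.≤ q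
    0≤q = ℚ.≤-trans 0≤p p≤q
    δ≤p : δ ℚ.≤ p
    δ≤p = ⅓≤p⇒δ≤p ⅓≤p
    δ≤q : δ ℚ.≤ q
    δ≤q = p≤½⇒δ≤q p≤½
    ½≤q : ℚ.½ ℚ.≤ q
    ½≤q = ≤-by (0≤- p≤½) (solve 1 (λ p → con 1ℚ :- p := con ℚ.½ :+ (con ℚ.½ :- p)) refl p)
    δ≤pq : δ ℚ.≤ p ℚ.* q
    δ≤pq = ℚ.≤-trans (from-yes (δ ℚ.≤? ⅓ ℚ.* ℚ.½)) (*-mono-≤ (from-yes (0ℚ ℚ.≤? ⅓)) 0≤q ⅓≤p ½≤q)
    0≤½-p = 0≤- p≤½
    0≤3p-1 : 0ℚ ℚ.≤ (p ℚ.+ p ℚ.+ p) ℚ.- 1ℚ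
    0≤3p-1 = 0≤- (ℚ.+-mono-≤ (ℚ.+-mono-≤ ⅓≤p ⅓≤p) ⅓≤p)
    0≤1-2p : 0ℚ ℚ.≤ 1ℚ ℚ.- (p ℚ.+ p)
    0≤1-2p = 0≤- (ℚ.+-mono-≤ p≤½ p≤½)

    -- An upper bound for the root in (0, 1) of x = p + q x³, which is the factor that one more common
    -- element costs a shifted 3-wise intersecting family.
    β : ℚ
    β = 5/4 ℚ.* p

    0≤β : 0ℚ ℚ.≤ β
    0≤β = from-yes (0ℚ ℚ.≤? 5/4) 0≤* 0≤p

    -- β − p − q β³ = (p / 4) (1 − (125 / 16) q p²), and q p² ≤ 1/8
    p+qβ³≤β : p ℚ.+ q ℚ.* (β ℚ.* (β ℚ.* β)) ℚ.≤ β
    p+qβ³≤β = ≤-by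
      (from-yes (0ℚ ℚ.≤? ¼) 0≤* 0≤p 0≤*
        (from-yes (0ℚ ℚ.≤? + 3 / 128) 0≤+ from-yes (0ℚ ℚ.≤? + 125 / 16) 0≤*
          (0≤½-p 0≤* (from-yes (0ℚ ℚ.≤? ¼) 0≤+ 0≤p 0≤* 0≤½-p))))
      (solve 1 (λ p → con 5/4 :* p := p :+ (con 1ℚ :- p) :* (con 5/4 :* p :* (con 5/4 :* p :* (con 5/4 :* p))) :+
        con ¼ :* p :* (con (+ 3 / 128) :+ con (+ 125 / 16) :*
          ((con ℚ.½ :- p) :* (con ¼ :+ p :* (con ℚ.½ :- p))))) refl p)

    -- The left side is `(61/16) p²`, which is largest at `p = 1/2`.
    p²+pβ+β²≤ : p ℚ.* p ℚ.+ p ℚ.* β ℚ.+ β ℚ.* β ℚ.≤ 61/64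
    p²+pβ+β²≤ = ≤-by
      (from-yes (0ℚ ℚ.≤? + 61 / 16) 0≤* (0≤½-p 0≤* (from-yes (0ℚ ℚ.≤? ℚ.½) 0≤+ 0≤p)))
      (solve 1 (λ p → con 61/64 := p :* p :+ p :* (con 5/4 :* p) :+ con 5/4 :* p :* (con 5/4 :* p) :+
        con (+ 61 / 16) :* ((con ℚ.½ :- p) :* (con ℚ.½ :+ p))) refl p)

    p³ : ℚ
    p³ = p ℚ.* p ℚ.* p

    0≤p³ : 0ℚ ℚ.≤ p³
    0≤p³ = 0≤p 0≤* 0≤p 0≤* 0≤p

    3-wise-small : ∀ {t} {F : Family n} → n ℕ.< t → 3-Wise t F → ¬ Inhabited F
    3-wise-small n<t w (A , A∈F) = ℕ.<⇒≱ n<t (ℕ.≤-trans (w A A A A∈F A∈F A∈F) (∣p∣≤n (A ∩ A ∩ A)))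

    empty≤ : ∀ {x} (F : Family n) → 0ℚ ℚ.≤ x → ¬ Inhabited F → M p q F ℚ.≤ x
    empty≤ F 0≤x ∄ = subst (ℚ._≤ _) (sym (M-empty {p} {q} F ∄)) 0≤x

  -- Unless its members all contain the first three elements, a shifted 3-wise 3-intersecting family
  -- has an intersecting link there, of measure at most p rather than 1.
  M-3-wise : ∀ {n} s {F : Family n} → UpClosed F → Shifted F → 3-Wise (3 ℕ.+ s) F → M p q F ℚ.≤ p³ ℚ.* β ^ s
  M-3-wise₃ : ∀ {n} {F : Family (3 ℕ.+ n)} → UpClosed F → Shifted F → 3-Wise 3 F →
    M p q F ℚ.≤ p³ ℚ.* (p ℚ.+ q ℚ.* 61/64) ⊎ M p q F ℚ.≤ p³ ℚ.* M p q (link inside (link inside (link inside F)))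

  M-3-wise {zero} s {F} u sh w = empty≤ F (0≤p³ 0≤* 0≤^ 0≤β s) (3-wise-small (s≤s z≤n) w)
  M-3-wise {suc n} (suc s) {F} (cons u₁ u₀ _) sh@(cons s₁ s₀ _) w =
    -- The links obey the bound with exponents `s` and `s + 3`, and `p + q β³ ≤ β` combines them to
    -- `s + 1`.
    ≤-by (0≤p 0≤* 0≤- (M-3-wise s u₁ s₁ (link-in-3-wise w))
          0≤+ 0≤q 0≤* 0≤- (M-3-wise (3 ℕ.+ s) u₀ s₀ (link-out-3-wise sh w))
          0≤+ 0≤p³ 0≤* (0≤- p+qβ³≤β 0≤* 0≤^ 0≤β s))
      (solve 7 (λ p q r β b x y → r :* (β :* b) := p :* x :+ q :* y :+
        (p :* (r :* b :- x) :+ q :* (r :* (β :* (β :* (β :* b))) :- y) :+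
         r :* ((β :- (p :+ q :* (β :* (β :* β)))) :* b))) refl
        p q p³ β (β ^ s) (M p q (link inside F)) (M p q (link outside F)))
  M-3-wise {1} zero {F} u sh w = empty≤ F (0≤p³ 0≤* 0≤^ 0≤β 0) (3-wise-small (s≤s (s≤s z≤n)) w)
  M-3-wise {2} zero {F} u sh w = empty≤ F (0≤p³ 0≤* 0≤^ 0≤β 0) (3-wise-small (s≤s (s≤s (s≤s z≤n))) w)
  M-3-wise {suc (suc (suc n))} zero {F} u sh w = [ (λ h → ℚ.≤-trans h (ℚ.*-monoˡ-≤-nonNeg p³ {{ℚ.nonNegative 0≤p³}}
      (≤-by (0≤q 0≤* from-yes (0ℚ ℚ.≤? + 3 / 64))
        (solve 1 (λ p → con 1ℚ := p :+ (con 1ℚ :- p) :* con 61/64 :+ (con 1ℚ :- p) :* con (+ 3 / 64)) refl p))))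
    , (λ h → ℚ.≤-trans h (ℚ.*-monoˡ-≤-nonNeg p³ {{ℚ.nonNegative 0≤p³}} (M≤1 0≤p 0≤q (p+[1-p]≡1 p) (link inside (link inside (link inside F)))))) ]′
    (M-3-wise₃ u sh w)

  M-3-wise₃ {n} {F} (cons (cons (cons u₁₁₁ u₁₁₀ _) u₁₀ b₁) u₀ b)
    sh@(cons sh₁@(cons sh₁₁@(cons s₁₁₁ s₁₁₀ _) s₁₀ adj₁) s₀ adj) w
    with inhabited? (link outside (link inside (link inside F)))
  -- Only 1 and 2 among the first three elements are common to such a `C` and two members containing
  -- all three, so the threefold inside link is intersecting. The other links are bounded with
  -- `s = 0, 1, 2`.
  ... | yes (C , C∈F) = inj₁ (≤-by
      (0≤p 0≤* (0≤p 0≤* (0≤p 0≤* 0≤- (M-intersecting 0≤p p≤q (p+[1-p]≡1 p) u₁₁₁ s₁₁₁ λ A B A∈F B∈F →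
            ℕ.≤-trans (s≤s⁻¹ (s≤s⁻¹ (w _ _ _ A∈F B∈F C∈F)))
              (subst (ℕ._≤ ∣ A ∩ B ∣) (cong ∣_∣ (∩-assoc A B C)) (∣p∩q∣≤∣p∣ (A ∩ B) C)))
          0≤+ 0≤q 0≤* 0≤- (M-3-wise 0 u₁₁₀ s₁₁₀ (link-out-3-wise sh₁₁ (link-in-3-wise (link-in-3-wise w)))))
        0≤+ 0≤q 0≤* 0≤- (M-3-wise 1 u₁₀ s₁₀ (link-out-3-wise sh₁ (link-in-3-wise w))))
       0≤+ 0≤q 0≤* 0≤- (M-3-wise 2 u₀ s₀ (link-out-3-wise sh w))
       0≤+ 0≤p³ 0≤* (0≤q 0≤* 0≤- p²+pβ+β²≤))
      (solve 8 (λ p q β κ x y z w → let p³ = p :* p :* p in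
         p³ :* (p :+ q :* κ) := p :* (p :* (p :* x :+ q :* y) :+ q :* z) :+ q :* w :+
          (p :* (p :* (p :* (p :- x) :+ q :* (p³ :* con 1ℚ :- y)) :+ q :* (p³ :* (β :* con 1ℚ) :- z)) :+
           q :* (p³ :* (β :* (β :* con 1ℚ)) :- w) :+ p³ :* (q :* (κ :- (p :* p :+ p :* β :+ β :* β))))) refl
        p q β 61/64 (M p q (link inside (link inside (link inside F))))
        (M p q (link outside (link inside (link inside F)))) (M p q (link outside (link inside F))) (M p q (link outside F))))
  -- A member missing 1 or 2 would lead, by adjacency or upward closure, to one that contains 1 and
  -- 2 but not 3.
  ... | no ∄ = inj₂ (ℚ.≤-reflexive (trans
      (cong₂ (λ x y → p ℚ.* x ℚ.+ q ℚ.* y)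
        (cong₂ (λ x y → p ℚ.* x ℚ.+ q ℚ.* y)
          (cong (λ y → p ℚ.* M p q (link inside (link inside (link inside F))) ℚ.+ q ℚ.* y)
            (M-empty {p} {q} (link outside (link inside (link inside F))) ∄))
          (M-empty {p} {q} (link outside (link inside F)) ∄₁₀))
        (M-empty {p} {q} (link outside F) ∄₀))
      (solve 3 (λ p q x → p :* (p :* (p :* x :+ q :* con 0ℚ) :+ q :* con 0ℚ) :+ q :* con 0ℚ := p :* p :* p :* x) refl
        p q (M p q (link inside (link inside (link inside F)))))))
    where
    ∄₁₀ : ¬ Inhabited (link outside (link inside F))
    ∄₁₀ (inside ∷ A , A∈F) = ∄ (A , adj₁ A A∈F)
    ∄₁₀ (outside ∷ A , A∈F) = ∄ (A , b₁ (outside ∷ A) A∈F)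
    ∄₀ : ¬ Inhabited (link outside F)
    ∄₀ (inside ∷ A , A∈F) = ∄₁₀ (A , adj A A∈F)
    ∄₀ (outside ∷ A , A∈F) = ∄₁₀ (A , b (outside ∷ A) A∈F)

  -- Both cases of `M-3-wise₃` leave room: `p³ q (3/64) ≥ δ³` in the first, the empty set missing
  -- from the threefold inside link in the second.
  M-3-wise-strict : ∀ {n} {F : Family (3 ℕ.+ n)} → UpClosed F → Shifted F → 3-Wise 3 F →
    ¬ inside ∷ inside ∷ inside ∷ ∅ ∈ᶠ F → M p q F ℚ.+ δ ^ (3 ℕ.+ n) ℚ.≤ p³
  M-3-wise-strict {n} {F} u sh w ∉F = [ (λ h → ≤-by
        (0≤- h 0≤+ 0≤- p³q≥δ³ 0≤+ from-yes (0ℚ ℚ.≤? δ ℚ.* δ ℚ.* δ) 0≤* 0≤- (δ^-mono {m = n} z≤n))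
        (solve 3 (λ p x e → p :* p :* p := x :+ con δ :* (con δ :* (con δ :* e)) :+
          ((p :* p :* p :* (p :+ (con 1ℚ :- p) :* con 61/64) :- x) :+
           (p :* p :* p :* ((con 1ℚ :- p) :* con (+ 3 / 64)) :- con δ :* con δ :* con δ) :+
           con δ :* con δ :* con δ :* (con 1ℚ :- e))) refl p (M p q F) (δ ^ n)))
    , (λ h → ≤-by
        (0≤- h 0≤+ 0≤p³ 0≤* 0≤- (ℚ.≤-trans
              (M-strict 0≤p 0≤q 0≤δ δ≤p δ≤q {F = F₁₁₁} {λ _ → true} (λ _ _ → tt) ∅ tt ∉F) (M≤1 {n} 0≤p 0≤q (p+[1-p]≡1 p) (λ _ → true)))
         0≤+ 0≤- (*-mono-≤ (0≤δ 0≤* 0≤δ) 0≤p (*-mono-≤ 0≤δ 0≤p δ≤p δ≤p) δ≤p) 0≤* 0≤^ 0≤δ n)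
        (solve 4 (λ p x y e → p :* p :* p := x :+ con δ :* (con δ :* (con δ :* e)) :+
          ((p :* p :* p :* y :- x) :+ p :* p :* p :* (con 1ℚ :- (y :+ e)) :+
           (p :* p :* p :- con δ :* con δ :* con δ) :* e)) refl p (M p q F) (M p q F₁₁₁) (δ ^ n))) ]′
    (M-3-wise₃ u sh w)
    where
    F₁₁₁ = link inside (link inside (link inside F))
    p³q≥δ³ : δ ℚ.* δ ℚ.* δ ℚ.≤ p³ ℚ.* (q ℚ.* (+ 3 / 64))
    p³q≥δ³ = ℚ.≤-trans (from-yes (δ ℚ.* δ ℚ.* δ ℚ.≤? ⅓ ℚ.* ⅓ ℚ.* ⅓ ℚ.* (ℚ.½ ℚ.* (+ 3 / 64))))
      (*-mono-≤ (from-yes (0ℚ ℚ.≤? ⅓ ℚ.* ⅓ ℚ.* ⅓)) (0≤q 0≤* from-yes (0ℚ ℚ.≤? + 3 / 64))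
        (*-mono-≤ (from-yes (0ℚ ℚ.≤? ⅓ ℚ.* ⅓)) 0≤p (*-mono-≤ (from-yes (0ℚ ℚ.≤? ⅓)) 0≤p ⅓≤p ⅓≤p) ⅓≤p)
        (ℚ.*-monoʳ-≤-nonNeg (+ 3 / 64) ½≤q))

  -- `3p − 1` vanishes at `p = 1/3` and `1 − 2p` at `p = 1/2`, so a gap is needed with each factor.
  -- The first comes from `{2,3,4} ∉ F` through `b≤p³`, the second from two links that differ or
  -- from `M-flip-strict`.
  M-shifted : ∀ {n} {F : Family (4 ℕ.+ n)} → UpClosed F → Shifted F → Spread F → 3-Wise 1 F →
    ¬ outside ∷ inside ∷ inside ∷ inside ∷ ∅ ∈ᶠ F →
    M p q F ℚ.+ δ ^ (4 ℕ.+ n) ℚ.≤ p ℚ.* p³ ℚ.+ + 4 / 1 ℚ.* (p³ ℚ.* q)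
  M-shifted {n} {F} (cons (cons uᵢᵢ uᵢₒ _) u₀@(cons uₒᵢ uₒₒ _) o⊑i) sh@(cons s₁@(cons _ sᵢₒ _) s₀ adj)
    sp@(cons (cons _ io⊤∈F) _) w ∉F = bound (inhabited? V)
    where
    D = link inside (link inside F)
    U₁ = link outside (link inside F)
    U₂ = link inside (link outside F)
    V = link outside (link outside F)
    d = M p q D
    u₁ = M p q U₁
    u₂ = M p q U₂
    v = M p q V
    w′ = M q p U₁
    e = δ ^ (2 ℕ.+ n)
    0≤e = 0≤^ 0≤δ (2 ℕ.+ n)

    2-wise : 2-Wise 2 F
    2-wise = 3-wise⇒2-wise sp w
    -- The underlying members of `F` share two elements, and 1 is the only one of them among 1 and
    -- 2.
    d+w≤1 : d ℚ.+ w′ ℚ.≤ 1ℚ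
    d+w≤1 = M-dual 0≤p 0≤q (p+[1-p]≡1 p) D U₁ λ A B A∈ B∈ → s≤s⁻¹ (2-wise _ _ A∈ B∈)
    b≤p³ : (p ℚ.* u₂ ℚ.+ q ℚ.* v) ℚ.+ δ ℚ.* e ℚ.≤ p³
    b≤p³ = M-3-wise-strict u₀ s₀ (link-out-3-wise sh w) ∉F
    u₂≤u₁ : u₂ ℚ.≤ u₁
    u₂≤u₁ = M-mono 0≤p 0≤q adj
    U₁-2-wise : 2-Wise 2 U₁
    U₁-2-wise = link-out-2-wise s₁ (link-in-2-wise 2-wise)
    -- From `p u₂ ≤ b ≤ p³ − δ e`, using `p ≤ 1` when dividing by `p`.
    δe≤p²-u₂ : δ ℚ.* e ℚ.≤ p ℚ.* p ℚ.- u₂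
    δe≤p²-u₂ = ℚ.*-cancelˡ-≤-pos p {{ℚ.positive (ℚ.<-≤-trans (from-yes (0ℚ ℚ.<? δ)) δ≤p)}}
      (≤-by (0≤- b≤p³ 0≤+ 0≤q 0≤* 0≤M 0≤p 0≤q V 0≤+ 0≤q 0≤* (0≤δ 0≤* 0≤e))
        (solve 4 (λ p u v e → p :* (p :* p :- u) := p :* (con δ :* e) :+
          ((p :* p :* p :- ((p :* u :+ (con 1ℚ :- p) :* v) :+ con δ :* e)) :+ (con 1ℚ :- p) :* v :+
           (con 1ℚ :- p) :* (con δ :* e))) refl p u₂ v e))

    bound : Dec (Inhabited V) → M p q F ℚ.+ δ ^ (4 ℕ.+ n) ℚ.≤ p ℚ.* p³ ℚ.+ + 4 / 1 ℚ.* (p³ ℚ.* q)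
    -- After multiplication by `p` the left side contains `p³ d`, which fits `d ≤ 1 − w` and
    -- `q³ u₁ ≤ p³ w`.
    bound (yes V∋@(A , A∈V)) = ℚ.*-cancelˡ-≤-pos p {{ℚ.positive (ℚ.<-≤-trans (from-yes (0ℚ ℚ.<? δ)) δ≤p)}}
      (≤-by
        (0≤p³ 0≤* 0≤- d+w≤1
         0≤+ 0≤- (M-flip 0≤p p≤q 3 uᵢₒ sᵢₒ (link-in-out-2-wise sh w V∋))
         0≤+ 0≤q 0≤* 0≤3p-1 0≤* 0≤- b≤p³
         -- `u₁ − b` is split as `p (u₁ − u₂) + q (u₁ − v)`.
         0≤+ 0≤q 0≤* 0≤1-2p 0≤* (0≤p 0≤* 0≤- u₂≤u₁ 0≤+ 0≤q 0≤* 0≤- v+e≤u₁ 0≤+ 0≤- δ≤q 0≤* 0≤e)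
         0≤+ 0≤p 0≤* 0≤- δ≤q 0≤* (0≤δ 0≤* 0≤e))
        (solve 7 (λ p d x y v w e → let q = con 1ℚ :- p ; p³ = p :* p :* p in
          p :* (p :* p³ :+ con (+ 4 / 1) :* (p³ :* q)) :=
          p :* (p :* (p :* d :+ q :* x) :+ q :* (p :* y :+ q :* v) :+ con δ :* (con δ :* e)) :+
          (p³ :* (con 1ℚ :- (d :+ w)) :+
           (p :* (p :* (p :* con 1ℚ)) :* w :- q :* (q :* (q :* con 1ℚ)) :* x) :+
           q :* (p :+ p :+ p :- con 1ℚ) :* (p³ :- (p :* y :+ q :* v :+ con δ :* e)) :+
           q :* (con 1ℚ :- (p :+ p)) :* (p :* (x :- y) :+ q :* (x :- (v :+ e)) :+ (q :- con δ) :* e) :+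
           p :* (q :- con δ) :* (con δ :* e))) refl p d u₁ u₂ v w′ e))
      where
      v+e≤u₁ : v ℚ.+ e ℚ.≤ u₁
      v+e≤u₁ = let B , B∈U₁ , B∉V = link-out-out-strict sh w _ A ℕ.≤-refl A∈V
               in M-strict 0≤p 0≤q 0≤δ δ≤p δ≤q (λ C → o⊑i (outside ∷ C)) B B∈U₁ B∉V
    bound (no ∄V) with T? (U₁ (inside ∷ inside ∷ ∅))
    -- `{1,3,4} ∈ F` and `{2,3,4} ∉ F` separate `U₁` from `U₂`.
    ... | yes ∈U₁ = ≤-by
        (0≤p 0≤* 0≤p 0≤* 0≤- d+w≤1
         0≤+ 0≤- (M-flip 0≤p p≤q 2 uᵢₒ sᵢₒ U₁-2-wise)
         0≤+ 0≤q 0≤* 0≤3p-1 0≤* 0≤- δe≤p²-u₂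
         0≤+ 0≤q 0≤* 0≤1-2p 0≤* 0≤- (M-strict 0≤p 0≤q 0≤δ δ≤p δ≤q adj (inside ∷ inside ∷ ∅) ∈U₁ ∉F)
         0≤+ 0≤q 0≤* 0≤q 0≤* 0≤- (ℚ.≤-reflexive (M-empty {p} {q} V ∄V))
         0≤+ (0≤q 0≤* 0≤1-2p 0≤* (0≤- δ≤1 0≤* 0≤e) 0≤+ 0≤- δ≤pq 0≤* (0≤δ 0≤* 0≤e)))
        (solve 7 (λ p d x y v w e → let q = con 1ℚ :- p ; p³ = p :* p :* p in
          p :* p³ :+ con (+ 4 / 1) :* (p³ :* q) :=
          p :* (p :* d :+ q :* x) :+ q :* (p :* y :+ q :* v) :+ con δ :* (con δ :* e) :+
          (p :* p :* (con 1ℚ :- (d :+ w)) :+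
           (p :* (p :* con 1ℚ) :* w :- q :* (q :* con 1ℚ) :* x) :+
           q :* (p :+ p :+ p :- con 1ℚ) :* (p :* p :- y :- con δ :* e) :+
           q :* (con 1ℚ :- (p :+ p)) :* (x :- (y :+ e)) :+
           q :* q :* (con 0ℚ :- v) :+
           (q :* (con 1ℚ :- (p :+ p)) :* ((con 1ℚ :- con δ) :* e) :+ (p :* q :- con δ) :* (con δ :* e)))) refl
          p d u₁ u₂ v w′ e)
    -- `U₁` lacks its initial 2-set, so the exchange of weights has a gap with the factor
    -- `q − p = 1 − 2p`.
    ... | no ∉U₁ = ≤-by
        (0≤p 0≤* 0≤p 0≤* 0≤- d+w≤1
         0≤+ 0≤- (M-flip-strict 0≤p p≤q 0≤δ δ≤1 δ≤q δ≤p δ≤pq 2 uᵢₒ sᵢₒ U₁-2-wise io⊤∈F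
               (subst (λ A → ¬ inside ∷ inside ∷ A ∈ᶠ U₁) (sym (initial-zero n)) ∉U₁))
         0≤+ 0≤q 0≤* 0≤3p-1 0≤* 0≤- δe≤p²-u₂
         0≤+ 0≤q 0≤* 0≤1-2p 0≤* 0≤- u₂≤u₁
         0≤+ 0≤q 0≤* 0≤q 0≤* 0≤- (ℚ.≤-reflexive (M-empty {p} {q} V ∄V))
         0≤+ (0≤p 0≤* 0≤1-2p 0≤* (0≤δ 0≤* 0≤e) 0≤+ 0≤- δ≤pq 0≤* (0≤δ 0≤* 0≤e)))
        (solve 7 (λ p d x y v w e → let q = con 1ℚ :- p ; p³ = p :* p :* p in
          p :* p³ :+ con (+ 4 / 1) :* (p³ :* q) :=
          p :* (p :* d :+ q :* x) :+ q :* (p :* y :+ q :* v) :+ con δ :* (con δ :* e) :+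
          (p :* p :* (con 1ℚ :- (d :+ w)) :+
           (p :* (p :* con 1ℚ) :* w :- (q :* (q :* con 1ℚ) :* x :+ (q :- p) :* (con δ :* e))) :+
           q :* (p :+ p :+ p :- con 1ℚ) :* (p :* p :- y :- con δ :* e) :+
           q :* (con 1ℚ :- (p :+ p)) :* (x :- y) :+
           q :* q :* (con 0ℚ :- v) :+
           (p :* (con 1ℚ :- (p :+ p)) :* (con δ :* e) :+ (p :* q :- con δ) :* (con δ :* e)))) refl
          p d u₁ u₂ v w′ e)

-- Cardinalities after adding or removing an element

∣p∣≤1+∣p-x∣ : ∀ (A : Subset n) x → ∣ A ∣ ℕ.≤ suc ∣ A - x ∣
∣p∣≤1+∣p-x∣ A x with x ∈? A
... | yes x∈A = ℕ.≤-reflexive (∣p∣≡1+∣p-x∣ x∈A)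
... | no x∉A = ℕ.m≤n⇒m≤1+n (p⊆q⇒∣p∣≤∣q∣ {p = A} {q = A - x} λ y∈A → x∈p∧x≢y⇒x∈p-y y∈A λ { refl → x∉A y∈A })

p⊆q∧∣q∣≤∣p∣⇒q⊆p : ∀ {A B : Subset n} → A ⊆ B → ∣ B ∣ ℕ.≤ ∣ A ∣ → B ⊆ A
p⊆q∧∣q∣≤∣p∣⇒q⊆p {A = A} A⊆B ∣B∣≤∣A∣ {x} x∈B with x ∈? A
... | yes x∈A = x∈A
... | no x∉A = contradiction ∣B∣≤∣A∣ (ℕ.<⇒≱ (p⊂q⇒∣p∣<∣q∣ (A⊆B , x , x∈B , x∉A)))

x∈p-y⇒x≢y : ∀ {A : Subset n} {x y} → x ∈ A - y → x ≢ y
x∈p-y⇒x≢y {A = a ∷ A} {zero} {zero} () refl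
x∈p-y⇒x≢y {A = a ∷ A} {suc x} {suc .x} (there x∈) refl = x∈p-y⇒x≢y {A = A} x∈ refl

∣p∪⁅x⁆∣ : ∀ {A : Subset n} {x} → x ∉ A → ∣ A ∪ ⁅ x ⁆ ∣ ≡ suc ∣ A ∣
∣p∪⁅x⁆∣ {A = inside ∷ A} {zero} x∉A = contradiction here x∉A
∣p∪⁅x⁆∣ {A = outside ∷ A} {zero} x∉A = cong (suc ∘ ∣_∣) (∪-identityʳ A)
∣p∪⁅x⁆∣ {A = inside ∷ A} {suc x} x∉A = cong suc (∣p∪⁅x⁆∣ (x∉A ∘ there))
∣p∪⁅x⁆∣ {A = outside ∷ A} {suc x} x∉A = ∣p∪⁅x⁆∣ (x∉A ∘ there)

------------------------------------------------------------------------
-- Families whose 3-sets have a common element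

BDMeasure : ℚ → ℚ
BDMeasure p = p ℚ.* (p ℚ.* p ℚ.* p) ℚ.+ + 4 / 1 ℚ.* (p ℚ.* p ℚ.* p ℚ.* (1ℚ ℚ.- p))

module _ {p : ℚ} (⅓≤p : + 1 / 3 ℚ.≤ p) (p≤½ : p ℚ.≤ + 1 / 2) where

  -- If `{2,3,4}` were a member, then shiftedness would add `{1,3,4}`, `{1,2,4}` and `{1,2,3}`, and
  -- these four sets have no common element.
  M-shifted-pinned : {F : Family n} → 4 ℕ.≤ n → UpClosed F → Shifted F → Spread F → 3-Wise 1 F →
    ∀ {x} → Pinned 3 F x → M p (1ℚ ℚ.- p) F ℚ.+ δ ^ n ℚ.≤ BDMeasure p
  M-shifted-pinned {suc (suc (suc (suc n)))} {F} (s≤s (s≤s (s≤s (s≤s z≤n)))) u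
    sh@(cons (cons (cons _ _ adj₂) _ adj₁) _ adj) sp w {x} pinned =
    M-shifted {p} ⅓≤p p≤½ {n} {F} u sh sp w λ ∈F → unpinned ∈F x pinned
    where
    3+∣∅∣≡3 : 3 ℕ.+ ∣ ∅ {n} ∣ ≡ 3
    3+∣∅∣≡3 = cong (3 ℕ.+_) (∣⊥∣≡0 n)
    unpinned : outside ∷ inside ∷ inside ∷ inside ∷ ∅ ∈ᶠ F → ∀ x → ¬ Pinned 3 F x
    unpinned ∈F zero h = case h ∈F 3+∣∅∣≡3 of λ ()
    unpinned ∈F (suc zero) h = case h (adj _ ∈F) 3+∣∅∣≡3 of λ { (there ()) }
    unpinned ∈F (suc (suc zero)) h = case h (adj₁ _ (adj _ ∈F)) 3+∣∅∣≡3 of λ { (there (there ())) }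
    unpinned ∈F (suc (suc (suc zero))) h = case h (adj₂ _ (adj₁ _ (adj _ ∈F))) 3+∣∅∣≡3 of λ { (there (there (there ()))) }
    unpinned ∈F (suc (suc (suc (suc x)))) h = case h ∈F 3+∣∅∣≡3 of λ { (there (there (there (there x∈∅)))) → ∉⊥ x∈∅ }

  -- Induction on `Ψ`: a shift keeps the measure and the hypotheses, with `pin` moving the common
  -- element.
  M-pinned : {F : Family n} → Acc ℕ._<_ (Ψ F) → 4 ℕ.≤ n → UpClosed F → Spread F → 3-Wise 1 F →
    ∀ {x} → Pinned 3 F x → M p (1ℚ ℚ.- p) F ℚ.+ δ ^ n ℚ.≤ BDMeasure p
  M-pinned {n} {F} (acc smaller) 4≤n u sp w pinned with shifted? F
  ... | inj₁ sh = M-shifted-pinned {n} {F} 4≤n u sh sp w pinned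
  ... | inj₂ (k , Ψ<) = subst (λ m → m ℚ.+ δ ^ n ℚ.≤ BDMeasure p) (M-shift {p} {1ℚ ℚ.- p} k F)
          (M-pinned {n} {shift k F} (smaller Ψ<) 4≤n (shift-upClosed k u) (shift-spread k sp) (shift-cross k w) (shift-pinned k pinned))

pinned? : ∀ c (F : Family n) x → Pinned c F x ⊎ ∃[ A ] A ∈ᶠ F × ∣ A ∣ ≡ c × x ∉ A
pinned? c F x with anySubset? (λ A → T? (F A) ×-dec (∣ A ∣ ℕ.≟ c) ×-dec ¬? (x ∈? A))
... | yes found = inj₂ found
... | no ∄A = inj₁ λ {A} A∈F ∣A∣≡c → decidable-stable (x ∈? A) λ x∉A → ∄A (A , A∈F , ∣A∣≡c , x∉A)

------------------------------------------------------------------------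
-- Copies of BD₃

-- F is the image of BD₃ in which the 4-set S plays the part of [4].
_IsBD₃On_ : Family n → Subset n → Set
F IsBD₃On S = ∣ S ∣ ≡ 4 × (∀ A → A ∈ᶠ F ⇔ 3 ℕ.≤ ∣ A ∩ S ∣)

module _ {F : Family n} (u : UpClosed F) (w : 2-Wise 2 F) where

  -- A member shares some `y` with `S` and two further elements with `S - y`. Conversely, a set with
  -- three elements of `S` contains some `S - x`.
  isBD₃On : ∀ {S} → ∣ S ∣ ≡ 4 → (∀ {x} → x ∈ S → S - x ∈ᶠ F) → F IsBD₃On S
  isBD₃On {S} ∣S∣≡4 S-x∈F = ∣S∣≡4 , λ A → mk⇔ (to A) (from A)
    where
    to : ∀ A → A ∈ᶠ F → 3 ℕ.≤ ∣ A ∩ S ∣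
    to A A∈F =
      let x , x∈S = 0<∣∣⇒Nonempty {A = S} (subst (0 ℕ.<_) (sym ∣S∣≡4) (s≤s z≤n))
          0<∣[S-x]∩A∣ = ℕ.≤-trans (s≤s z≤n) (w _ _ (S-x∈F x∈S) A∈F)
          0<∣S∩A∣ = ℕ.≤-trans 0<∣[S-x]∩A∣
            (subst (ℕ._≤ ∣ S ∩ A ∣) (cong ∣_∣ (∩-- S A x)) (∣p─q∣≤∣p∣ (S ∩ A) ⁅ x ⁆))
          y , y∈S , _ , eq = common S A 0<∣S∩A∣
      in subst (3 ℕ.≤_) (trans (sym eq) (cong ∣_∣ (∩-comm S A))) (s≤s (w _ _ (S-x∈F y∈S) A∈F))
    from : ∀ A → 3 ℕ.≤ ∣ A ∩ S ∣ → A ∈ᶠ F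
    from A 3≤∣A∩S∣ with any? (λ x → (x ∈? S) ×-dec ¬? (x ∈? A))
    ... | yes (x , x∈S , x∉A) = up u
            (λ {y} y∈ → proj₁ (x∈p∩q⁻ A S (p⊆q∧∣q∣≤∣p∣⇒q⊆p {A = A ∩ S} {S - x}
              (λ z∈ → let z∈A , z∈S = x∈p∩q⁻ A S z∈ in x∈p∧x≢y⇒x∈p-y z∈S λ { refl → x∉A z∈A })
              (ℕ.≤-trans (ℕ.≤-reflexive (ℕ.suc-injective (trans (sym (∣p∣≡1+∣p-x∣ x∈S)) ∣S∣≡4))) 3≤∣A∩S∣) y∈)))
            (S-x∈F x∈S)
    ... | no ∄x =
      let x , x∈S = 0<∣∣⇒Nonempty {A = S} (subst (0 ℕ.<_) (sym ∣S∣≡4) (s≤s z≤n))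
      in up u (λ {y} y∈ → decidable-stable (y ∈? A) λ y∉A → ∄x (y , p─q⊆p S ⁅ x ⁆ y∈ , y∉A)) (S-x∈F x∈S)

  -- Two 3-sets that meet in two elements, the second missing a, span a 4-set S. The
  -- 3-set missing an element x common to both must be S − x.
  unpinned⇒BD₃ : Fin n → (∀ x → ∃[ A ] A ∈ᶠ F × ∣ A ∣ ≡ 3 × x ∉ A) → ∃[ S ] F IsBD₃On S
  unpinned⇒BD₃ x₀ missing =
    let G , G∈F , ∣G∣≡3 , _ = missing x₀
        a , a∈G = 0<∣∣⇒Nonempty {A = G} (subst (0 ℕ.<_) (sym ∣G∣≡3) (s≤s z≤n))
        A , A∈F , ∣A∣≡3 , a∉A = missing a
        G-a⊆A = 3-set-x⊆ G∈F ∣G∣≡3 A∈F a∈G a∉A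
        ∣S∣≡4 = trans (∣p∪⁅x⁆∣ a∉A) (cong suc ∣A∣≡3)
        S-x∈F : ∀ {x} → x ∈ A ∪ ⁅ a ⁆ → (A ∪ ⁅ a ⁆) - x ∈ᶠ F
        S-x∈F {x} x∈S = case x ∈? G of λ where
          (no x∉G) → up u
            (λ {y} y∈G → x∈p∧x≢y⇒x∈p-y (x∈p∪q⁺ (case y ≟ a of λ where
                (yes refl) → inj₂ (x∈⁅x⁆ a)
                (no y≢a) → inj₁ (G-a⊆A (x∈p∧x≢y⇒x∈p-y y∈G y≢a))))
              λ { refl → x∉G y∈G })
            G∈F
          (yes x∈G) → case x ≟ a of λ where
            (yes refl) → up u
              (λ y∈A → x∈p∧x≢y⇒x∈p-y (x∈p∪q⁺ (inj₁ y∈A)) λ { refl → a∉A y∈A }) A∈F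
            (no x≢a) →
              let B , B∈F , ∣B∣≡3 , x∉B = missing x
                  x∈A = G-a⊆A (x∈p∧x≢y⇒x∈p-y x∈G x≢a)
                  S-x⊆B : (A ∪ ⁅ a ⁆) - x ⊆ B
                  S-x⊆B = λ {y} y∈ → case x∈p∪q⁻ A ⁅ a ⁆ (p─q⊆p (A ∪ ⁅ a ⁆) ⁅ x ⁆ y∈) of λ where
                    (inj₁ y∈A) → 3-set-x⊆ A∈F ∣A∣≡3 B∈F x∈A x∉B (x∈p∧x≢y⇒x∈p-y y∈A (x∈p-y⇒x≢y {A = A ∪ ⁅ a ⁆} y∈))
                    (inj₂ y∈a) → 3-set-x⊆ G∈F ∣G∣≡3 B∈F x∈G x∉B
                      (x∈p∧x≢y⇒x∈p-y (subst (_∈ G) (sym (x∈⁅y⁆⇒x≡y a y∈a)) a∈G) (x∈p-y⇒x≢y {A = A ∪ ⁅ a ⁆} y∈))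
              in up u (p⊆q∧∣q∣≤∣p∣⇒q⊆p S-x⊆B (ℕ.≤-reflexive
                   (trans ∣B∣≡3 (ℕ.suc-injective (trans (sym ∣S∣≡4) (∣p∣≡1+∣p-x∣ x∈S)))))) B∈F
    in A ∪ ⁅ a ⁆ , isBD₃On ∣S∣≡4 S-x∈F
    where
    -- `A` misses `x` and shares two elements with the 3-set `G`, so it contains the other two.
    3-set-x⊆ : ∀ {G A x} → G ∈ᶠ F → ∣ G ∣ ≡ 3 → A ∈ᶠ F → x ∈ G → x ∉ A → G - x ⊆ A
    3-set-x⊆ {G} {A} {x} G∈F ∣G∣≡3 A∈F x∈G x∉A {y} y∈ = proj₁ (x∈p∩q⁻ A G
      (p⊆q∧∣q∣≤∣p∣⇒q⊆p {A = A ∩ G} {G - x}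
        (λ z∈ → let z∈A , z∈G = x∈p∩q⁻ A G z∈ in x∈p∧x≢y⇒x∈p-y z∈G λ { refl → x∉A z∈A })
        (ℕ.≤-trans (ℕ.≤-reflexive (ℕ.suc-injective (trans (sym (∣p∣≡1+∣p-x∣ x∈G)) ∣G∣≡3))) (w _ _ A∈F G∈F)) y∈))

-- The measure of BD₃

-- The probability of at least `j` successes in `t` independent trials with success probability `p`.
tail : ℚ → ℕ → ℕ → ℚ
tail p t       zero    = 1ℚ
tail p zero    (suc j) = 0ℚ
tail p (suc t) (suc j) = p ℚ.* tail p t j ℚ.+ (1ℚ ℚ.- p) ℚ.* tail p t (suc j)

M-tail : ∀ p j (S : Subset n) → M p (1ℚ ℚ.- p) (λ A → j ℕ.≤ᵇ ∣ A ∩ S ∣) ≡ tail p ∣ S ∣ j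
M-tail p zero [] = refl
M-tail p (suc j) [] = refl
M-tail p j (outside ∷ S) = trans
  (cong₂ (λ x y → p ℚ.* x ℚ.+ (1ℚ ℚ.- p) ℚ.* y) (M-tail p j S) (M-tail p j S))
  (solve 2 (λ p x → p :* x :+ (con 1ℚ :- p) :* x := x) refl p (tail p ∣ S ∣ j))
M-tail p zero (inside ∷ S) = trans
  (cong₂ (λ x y → p ℚ.* x ℚ.+ (1ℚ ℚ.- p) ℚ.* y) (M-tail p zero S) (M-tail p zero S))
  (solve 1 (λ p → p :* con 1ℚ :+ (con 1ℚ :- p) :* con 1ℚ := con 1ℚ) refl p)
M-tail p (suc j) (inside ∷ S) = cong₂ (λ x y → p ℚ.* x ℚ.+ (1ℚ ℚ.- p) ℚ.* y)
  (trans (M-cong _ _ (λ A → suc-≤ᵇ j ∣ A ∩ S ∣)) (M-tail p j S)) (M-tail p (suc j) S)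
  where
  suc-≤ᵇ : ∀ j k → (suc j ℕ.≤ᵇ suc k) ≡ (j ℕ.≤ᵇ k)
  suc-≤ᵇ zero    k = refl
  suc-≤ᵇ (suc j) k = refl

tail-4-3 : ∀ p → tail p 4 3 ≡ BDMeasure p
tail-4-3 = solve 1 (λ p →
  let q = con 1ℚ :- p
      -- The indices are the arguments of `tail p`; `t₁₂` also stands for `tail p 1 3`, which
      -- unfolds to the same term.
      t₁₁ = p :* con 1ℚ :+ q :* con 0ℚ
      t₁₂ = p :* con 0ℚ :+ q :* con 0ℚ
      t₂₁ = p :* con 1ℚ :+ q :* t₁₁
      t₂₂ = p :* t₁₁ :+ q :* t₁₂
      t₂₃ = p :* t₁₂ :+ q :* t₁₂
  in p :* (p :* t₂₁ :+ q :* t₂₂) :+ q :* (p :* t₂₂ :+ q :* t₂₃)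
     := p :* (p :* p :* p) :+ con (+ 4 / 1) :* (p :* p :* p :* q)) refl

M-BD₃ : ∀ p {F : Family n} {S} → F IsBD₃On S → M p (1ℚ ℚ.- p) F ≡ BDMeasure p
M-BD₃ p {F} {S} (∣S∣≡4 , F⇔) = trans (M-cong F _ F≗)
  (trans (M-tail p 3 S) (trans (cong (λ t → tail p t 3) ∣S∣≡4) (tail-4-3 p)))
  where
  T-⇔⇒≡ : ∀ {a b} → T a ⇔ T b → a ≡ b
  T-⇔⇒≡ {true}  {true}  _ = refl
  T-⇔⇒≡ {true}  {false} e = ⊥-elim (Equivalence.to e tt)
  T-⇔⇒≡ {false} {true}  e = ⊥-elim (Equivalence.from e tt)
  T-⇔⇒≡ {false} {false} _ = refl
  F≗ : ∀ A → F A ≡ (3 ℕ.≤ᵇ ∣ A ∩ S ∣)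
  F≗ A = T-⇔⇒≡ (mk⇔ (ℕ.≤⇒≤ᵇ ∘ Equivalence.to (F⇔ A)) (Equivalence.from (F⇔ A) ∘ ℕ.≤ᵇ⇒≤ 3 _))

-- BD₃ as a non-trivial 3-wise intersecting family

∣[4]∣≡4 : 4 ℕ.≤ n → ∣ [4] {n} ∣ ≡ 4
∣[4]∣≡4 (s≤s (s≤s (s≤s (s≤s (z≤n {n}))))) = cong (4 ℕ.+_) (trans (cong ∣_∣ (tabulate-outside n)) (∣⊥∣≡0 n))
  where
  tabulate-outside : ∀ n → tabulate {n = n} (λ _ → outside) ≡ ∅
  tabulate-outside zero    = refl
  tabulate-outside (suc n) = cong (outside ∷_) (tabulate-outside n)

BD₃-isBD₃On : 4 ℕ.≤ n → BD₃ n IsBD₃On [4]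
BD₃-isBD₃On 4≤n = ∣[4]∣≡4 4≤n , λ A → mk⇔ (ℕ.≤ᵇ⇒≤ 3 _) ℕ.≤⇒≤ᵇ

-- Inclusion and exclusion inside `S`, where the union has at most `∣ S ∣` elements.
∣A∩S∣+∣B∩S∣≤ : ∀ (A B S : Subset n) → ∣ A ∩ S ∣ ℕ.+ ∣ B ∩ S ∣ ℕ.≤ ∣ S ∣ ℕ.+ ∣ (A ∩ B) ∩ S ∣
∣A∩S∣+∣B∩S∣≤ [] [] [] = z≤n
∣A∩S∣+∣B∩S∣≤ (a ∷ A) (b ∷ B) (outside ∷ S) rewrite ∧-zeroʳ a | ∧-zeroʳ b | ∧-zeroʳ (a ∧ b) = ∣A∩S∣+∣B∩S∣≤ A B S
∣A∩S∣+∣B∩S∣≤ (inside ∷ A) (inside ∷ B) (inside ∷ S) = s≤s (subst₂ ℕ._≤_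
  (sym (ℕ.+-suc ∣ A ∩ S ∣ ∣ B ∩ S ∣)) (sym (ℕ.+-suc ∣ S ∣ ∣ (A ∩ B) ∩ S ∣)) (s≤s (∣A∩S∣+∣B∩S∣≤ A B S)))
∣A∩S∣+∣B∩S∣≤ (inside ∷ A) (outside ∷ B) (inside ∷ S) = s≤s (∣A∩S∣+∣B∩S∣≤ A B S)
∣A∩S∣+∣B∩S∣≤ (outside ∷ A) (inside ∷ B) (inside ∷ S) =
  subst (ℕ._≤ suc (∣ S ∣ ℕ.+ ∣ (A ∩ B) ∩ S ∣)) (sym (ℕ.+-suc ∣ A ∩ S ∣ ∣ B ∩ S ∣)) (s≤s (∣A∩S∣+∣B∩S∣≤ A B S))
∣A∩S∣+∣B∩S∣≤ (outside ∷ A) (outside ∷ B) (inside ∷ S) = ℕ.m≤n⇒m≤1+n (∣A∩S∣+∣B∩S∣≤ A B S)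

BD₃-3-wise : 4 ℕ.≤ n → 3-WiseIntersecting (BD₃ n)
BD₃-3-wise {n} 4≤n {A} {B} {C} A∈ B∈ C∈ = 0<∣∣⇒Nonempty {A = A ∩ B ∩ C} (ℕ.≤-trans
  (excess 2≤∣A∩B∩S∣ (ℕ.≤ᵇ⇒≤ 3 ∣ C ∩ [4] ∣ C∈) (bound (A ∩ B) C))
  (subst (∣ ((A ∩ B) ∩ C) ∩ [4] ∣ ℕ.≤_) (cong ∣_∣ (∩-assoc A B C)) (∣p∩q∣≤∣p∣ ((A ∩ B) ∩ C) [4])))
  where
  excess : ∀ {i j k x y} → i ℕ.≤ x → j ℕ.≤ y → x ℕ.+ y ℕ.≤ 4 ℕ.+ k → i ℕ.+ j ℕ.∸ 4 ℕ.≤ k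
  excess i≤x j≤y x+y≤ = ℕ.m≤n+o⇒m∸n≤o _ 4 (ℕ.≤-trans (ℕ.+-mono-≤ i≤x j≤y) x+y≤)
  bound : ∀ (A B : Subset n) → ∣ A ∩ [4] ∣ ℕ.+ ∣ B ∩ [4] ∣ ℕ.≤ 4 ℕ.+ ∣ (A ∩ B) ∩ [4] ∣
  bound A B = subst (λ s → ∣ A ∩ [4] ∣ ℕ.+ ∣ B ∩ [4] ∣ ℕ.≤ s ℕ.+ ∣ (A ∩ B) ∩ [4] ∣) (∣[4]∣≡4 4≤n) (∣A∩S∣+∣B∩S∣≤ A B [4])
  2≤∣A∩B∩S∣ : 2 ℕ.≤ ∣ (A ∩ B) ∩ [4] ∣
  2≤∣A∩B∩S∣ = excess (ℕ.≤ᵇ⇒≤ 3 ∣ A ∩ [4] ∣ A∈) (ℕ.≤ᵇ⇒≤ 3 ∣ B ∩ [4] ∣ B∈) (bound A B)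

∈-subsets : ∀ (A : Subset n) → A ∈ˡ subsets n
∈-subsets [] = hereˡ refl
∈-subsets (inside ∷ A) = ∈-++⁺ˡ (∈-map⁺ (inside ∷_) (∈-subsets A))
∈-subsets (outside ∷ A) = ∈-++⁺ʳ _ (∈-map⁺ (outside ∷_) (∈-subsets A))

⋂-filterᵇ-⊆ : ∀ (F : Family n) As {A} → A ∈ˡ As → A ∈ᶠ F → ⋂ (filterᵇ F As) ⊆ A
⋂-filterᵇ-⊆ F (B ∷ˡ As) (hereˡ refl) A∈F x∈ with F B
... | true = proj₁ (x∈p∩q⁻ B (⋂ (filterᵇ F As)) x∈)
⋂-filterᵇ-⊆ F (B ∷ˡ As) (thereˡ A∈As) A∈F x∈ with F B
... | true  = ⋂-filterᵇ-⊆ F As A∈As A∈F (proj₂ (x∈p∩q⁻ B (⋂ (filterᵇ F As)) x∈))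
... | false = ⋂-filterᵇ-⊆ F As A∈As A∈F x∈

∈-⋂-filterᵇ : ∀ (F : Family n) As {x} → (∀ {A} → A ∈ᶠ F → x ∈ A) → x ∈ ⋂ (filterᵇ F As)
∈-⋂-filterᵇ F []ˡ x∈F = ∈⊤
∈-⋂-filterᵇ F (A ∷ˡ As) x∈F with F A in FA
... | true  = x∈p∩q⁺ (x∈F (subst T (sym FA) tt) , ∈-⋂-filterᵇ F As x∈F)
... | false = ∈-⋂-filterᵇ F As x∈F

nonTrivial⇒∃∌ : {F : Family n} → NonTrivial F → ∀ x → ∃[ A ] A ∈ᶠ F × x ∉ A
nonTrivial⇒∃∌ {F = F} nt x with anySubset? (λ A → T? (F A) ×-dec ¬? (x ∈? A))
... | yes found = found
... | no ∄A = ⊥-elim (nt (x , ∈-⋂-filterᵇ F (subsets _) λ {A} A∈F →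
                decidable-stable (x ∈? A) λ x∉A → ∄A (A , A∈F , x∉A)))

-- Every `⊤ - x` is a member, since it keeps at least three elements of `[4]`.
BD₃-nonTrivial : 4 ℕ.≤ n → NonTrivial (BD₃ n)
BD₃-nonTrivial {n} 4≤n (x , x∈) = x∈p-y⇒x≢y {A = ⊤} (⋂-filterᵇ-⊆ (BD₃ n) (subsets n) (∈-subsets (⊤ - x))
  (ℕ.≤⇒≤ᵇ (ℕ.≤-trans (s≤s⁻¹ (ℕ.≤-trans (ℕ.≤-reflexive (sym (∣[4]∣≡4 4≤n))) (∣p∣≤1+∣p-x∣ [4] x)))
    (ℕ.≤-reflexive (cong ∣_∣ (trans (cong (_- x) (sym (∩-identityˡ [4]))) (∩-- ⊤ [4] x)))))) x∈) refl

------------------------------------------------------------------------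
-- Isomorphisms

lookup-- : ∀ (A : Subset n) {x y} → y ≢ x → lookup (A - x) y ≡ lookup A y
lookup-- (a ∷ A) {zero} {zero} y≢x = contradiction refl y≢x
lookup-- (a ∷ A) {zero} {suc y} y≢x = cong (λ A → lookup A y) (p─⊥≡p A)
lookup-- (a ∷ A) {suc x} {zero} y≢x = refl
lookup-- (a ∷ A) {suc x} {suc y} y≢x = lookup-- A (y≢x ∘ cong suc)

lookup---same : ∀ (A : Subset n) x → lookup (A - x) x ≡ outside
lookup---same (a ∷ A) zero = refl
lookup---same (a ∷ A) (suc x) = lookup---same A x

lookup-transpose : ∀ (A : Subset n) {x} → x ∈ A → ∀ y →
  lookup (outside ∷ A) (transposeᶠ (suc x) zero y) ≡ lookup (inside ∷ (A - x)) y
lookup-transpose A x∈A zero = []=⇒lookup x∈A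
lookup-transpose A {x} x∈A (suc y) with y ≟ x
... | yes refl = sym (lookup---same A x)
... | no y≢x = sym (lookup-- A y≢x)

-- Where the first entries differ, an element `x` of the set lacking the first one is transposed
-- with the first position.
permutation-between : ∀ (A B : Subset n) → ∣ A ∣ ≡ ∣ B ∣ →
  Σ[ τ ∈ Permutation′ n ] (∀ x → lookup A (τ ⟨$⟩ˡ x) ≡ lookup B x)
permutation-between [] [] _ = Permutation.id , λ ()
permutation-between (inside ∷ A) (inside ∷ B) ∣A∣≡∣B∣ =
  let τ , τ≗ = permutation-between A B (ℕ.suc-injective ∣A∣≡∣B∣)
  in lift₀ τ , λ { zero → refl ; (suc x) → τ≗ x }
permutation-between (outside ∷ A) (outside ∷ B) ∣A∣≡∣B∣ =
  let τ , τ≗ = permutation-between A B ∣A∣≡∣B∣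
  in lift₀ τ , λ { zero → refl ; (suc x) → τ≗ x }
permutation-between (inside ∷ A) (outside ∷ B) ∣A∣≡∣B∣ =
  let x , x∈B = 0<∣∣⇒Nonempty {A = B} (subst (0 ℕ.<_) ∣A∣≡∣B∣ (s≤s z≤n))
      τ , τ≗ = permutation-between A (B - x) (ℕ.suc-injective (trans ∣A∣≡∣B∣ (∣p∣≡1+∣p-x∣ x∈B)))
      lift-τ≗ : ∀ y → lookup (inside ∷ A) (lift₀ τ ⟨$⟩ˡ y) ≡ lookup (inside ∷ (B - x)) y
      lift-τ≗ = λ { zero → refl ; (suc y) → τ≗ y }
  in lift₀ τ ∘ₚ transpose (suc x) zero , λ y →
     trans (lift-τ≗ (transposeᶠ zero (suc x) y)) (trans (sym (lookup-transpose B x∈B (transposeᶠ zero (suc x) y)))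
       (cong (lookup (outside ∷ B)) (transpose-inverse (suc x) zero {y})))
permutation-between (outside ∷ A) (inside ∷ B) ∣A∣≡∣B∣ =
  let x , x∈A = 0<∣∣⇒Nonempty {A = A} (subst (0 ℕ.<_) (sym ∣A∣≡∣B∣) (s≤s z≤n))
      τ , τ≗ = permutation-between (A - x) B (ℕ.suc-injective (trans (sym (∣p∣≡1+∣p-x∣ x∈A)) ∣A∣≡∣B∣))
      lift-τ≗ : ∀ y → lookup (inside ∷ (A - x)) (lift₀ τ ⟨$⟩ˡ y) ≡ lookup (inside ∷ B) y
      lift-τ≗ = λ { zero → refl ; (suc y) → τ≗ y }
  in transpose zero (suc x) ∘ₚ lift₀ τ , λ y →
     trans (lookup-transpose A x∈A (lift₀ τ ⟨$⟩ˡ y)) (lift-τ≗ y)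

∣p∣≡sum : ∀ (A : Subset n) → ∣ A ∣ ≡ Sum.sum (λ x → if lookup A x then 1 else 0)
∣p∣≡sum [] = refl
∣p∣≡sum (inside ∷ A) = cong suc (∣p∣≡sum A)
∣p∣≡sum (outside ∷ A) = ∣p∣≡sum A

∣τ[p]∣ : ∀ (τ : Permutation′ n) A → ∣ τ [ A ] ∣ ≡ ∣ A ∣
∣τ[p]∣ τ A = trans (∣p∣≡sum (τ [ A ])) (trans
  (Sum.sum-cong-≗ (λ x → cong (λ b → if b then 1 else 0) (lookup∘tabulate (λ y → lookup A (τ ⟨$⟩ˡ y)) x)))
  (trans (sym (Sum.sum-permute (λ x → if lookup A x then 1 else 0) (flip τ))) (sym (∣p∣≡sum A))))

τ[p]∩ : ∀ (τ : Permutation′ n) {A S S′} → (∀ x → lookup S (τ ⟨$⟩ˡ x) ≡ lookup S′ x) → τ [ A ] ∩ S′ ≡ τ [ A ∩ S ]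
τ[p]∩ τ {A} {S} {S′} τ≗ = trans (sym (tabulate∘lookup (τ [ A ] ∩ S′))) (tabulate-cong λ x → trans
  (lookup-zipWith _∧_ x (τ [ A ]) S′) (trans
  (cong₂ _∧_ (lookup∘tabulate (λ y → lookup A (τ ⟨$⟩ˡ y)) x) (sym (τ≗ x)))
  (sym (lookup-zipWith _∧_ (τ ⟨$⟩ˡ x) A S))))

τ[τ⁻¹[p]] : ∀ (τ : Permutation′ n) A → A ≡ τ [ flip τ [ A ] ]
τ[τ⁻¹[p]] τ A = trans (sym (tabulate∘lookup A)) (tabulate-cong λ x → sym (trans
  (lookup∘tabulate (λ y → lookup A (τ ⟨$⟩ʳ y)) (τ ⟨$⟩ˡ x)) (cong (lookup A) (inverseʳ τ))))

isBD₃On⇒≅ : {F G : Family n} → ∀ {S S′} → F IsBD₃On S → G IsBD₃On S′ → F ≅ G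
isBD₃On⇒≅ {n} {S = S} {S′} (∣S∣≡4 , F⇔) (∣S′∣≡4 , G⇔) =
  let τ , τ≗ = permutation-between S′ S (trans ∣S′∣≡4 (sym ∣S∣≡4))
      ∣τ[A]∩S∣ : ∀ A → ∣ τ [ A ] ∩ S ∣ ≡ ∣ A ∩ S′ ∣
      ∣τ[A]∩S∣ = λ A → trans (cong ∣_∣ (τ[p]∩ τ {A} {S′} {S} τ≗)) (∣τ[p]∣ τ (A ∩ S′))
  in τ , λ A → mk⇔
    (λ A∈F → flip τ [ A ] , Equivalence.from (G⇔ (flip τ [ A ])) (subst (3 ℕ.≤_)
        (trans (cong (λ B → ∣ B ∩ S ∣) (τ[τ⁻¹[p]] τ A)) (∣τ[A]∩S∣ (flip τ [ A ])))
        (Equivalence.to (F⇔ A) A∈F)) , τ[τ⁻¹[p]] τ A)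
    λ { (B , B∈G , refl) → Equivalence.from (F⇔ (τ [ B ]))
          (subst (3 ℕ.≤_) (sym (∣τ[A]∩S∣ B)) (Equivalence.to (G⇔ B) B∈G)) }

------------------------------------------------------------------------
-- The dichotomy for rational p

BelowBD₃ : Family n → Set
BelowBD₃ {n} F = ∀ {p} → + 1 / 3 ℚ.≤ p → p ℚ.≤ + 1 / 2 → M p (1ℚ ℚ.- p) F ℚ.+ δ ^ n ℚ.≤ BDMeasure p

module _ {F : Family n} (4≤n : 4 ℕ.≤ n) (nt : NonTrivial F) (w : 3-WiseIntersecting F) where

  private
    F↑ = upClosure F

    F↑-spread : Spread F↑
    F↑-spread = ⊤-x⇒spread F↑ λ x → let A , A∈F , x∉A = nonTrivial⇒∃∌ nt x in
      up (upClosure-upClosed F) (λ y∈A → x∈p∧x≢y⇒x∈p-y ∈⊤ λ { refl → x∉A y∈A }) (⊑-upClosure F A A∈F)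

    F↑-3-wise : 3-Wise 1 F↑
    F↑-3-wise A B C A∈ B∈ C∈ =
      let A′ , A′⊆A , A′∈F = upClosure⁻ F A A∈
          B′ , B′⊆B , B′∈F = upClosure⁻ F B B∈
          C′ , C′⊆C , C′∈F = upClosure⁻ F C C∈
          x , x∈ = w A′∈F B′∈F C′∈F
          x∈A′ , x∈B′∩C′ = x∈p∩q⁻ A′ (B′ ∩ C′) x∈
          x∈B′ , x∈C′ = x∈p∩q⁻ B′ C′ x∈B′∩C′
      in Nonempty⇒0<∣∣ {A = A ∩ B ∩ C} (x , x∈p∩q⁺ (A′⊆A x∈A′ , x∈p∩q⁺ (B′⊆B x∈B′ , C′⊆C x∈C′)))

    0≤p : ∀ {p} → + 1 / 3 ℚ.≤ p → 0ℚ ℚ.≤ p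
    0≤p = ℚ.≤-trans 0≤δ ∘ ⅓≤p⇒δ≤p
    0≤q : ∀ {p} → p ℚ.≤ + 1 / 2 → 0ℚ ℚ.≤ 1ℚ ℚ.- p
    0≤q = ℚ.≤-trans 0≤δ ∘ p≤½⇒δ≤q

    pinned⇒below : ∀ {x} → Pinned 3 F↑ x → BelowBD₃ F
    pinned⇒below {x} h {p} ⅓≤p p≤½ = ℚ.≤-trans
      (ℚ.+-monoˡ-≤ (δ ^ n) (M-mono {p} {1ℚ ℚ.- p} (0≤p ⅓≤p) (0≤q p≤½) {F = F} {F↑} (⊑-upClosure F)))
      (M-pinned {p} ⅓≤p p≤½ {n} {F↑} (<-wellFounded (Ψ F↑)) 4≤n (upClosure-upClosed F) F↑-spread F↑-3-wise {x} h)

    -- The upward closure already has the measure of BD₃, and the missing set `A` weighs at least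
    -- `δ ^ n`.
    proper⇒below : ∀ {S A} → F↑ IsBD₃On S → A ∈ᶠ F↑ → ¬ A ∈ᶠ F → BelowBD₃ F
    proper⇒below {S} {A} isBD A∈F↑ A∉F {p} ⅓≤p p≤½ =
      subst (M p (1ℚ ℚ.- p) F ℚ.+ δ ^ n ℚ.≤_) (M-BD₃ p {F↑} {S} isBD)
        (M-strict {p} {1ℚ ℚ.- p} (0≤p ⅓≤p) (0≤q p≤½) {δ} 0≤δ (⅓≤p⇒δ≤p ⅓≤p) (p≤½⇒δ≤q p≤½) {F = F} {F↑}
          (⊑-upClosure F) A A∈F↑ A∉F)

    pinned-dec : ∀ x → Dec (Pinned 3 F↑ x)
    pinned-dec x with pinned? 3 F↑ x
    ... | inj₁ h = yes h
    ... | inj₂ (A , A∈ , ∣A∣≡3 , x∉A) = no λ h → x∉A (h A∈ ∣A∣≡3)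

    BD₃⇒ : ∃[ S ] F↑ IsBD₃On S → BelowBD₃ F ⊎ ∃[ S ] F IsBD₃On S
    BD₃⇒ (S , isBD@(∣S∣≡4 , F↑⇔)) with anySubset? (λ A → T? (F↑ A) ×-dec ¬? (T? (F A)))
    ... | yes (A , A∈F↑ , A∉F) = inj₁ (proper⇒below {S} {A} isBD A∈F↑ A∉F)
    ... | no ∄A = inj₂ (S , ∣S∣≡4 , λ A → mk⇔
            (Equivalence.to (F↑⇔ A) ∘ ⊑-upClosure F A)
            (λ 3≤ → decidable-stable (T? (F A)) λ A∉F → ∄A (A , Equivalence.from (F↑⇔ A) 3≤ , A∉F)))

  below-or-BD₃ : BelowBD₃ F ⊎ ∃[ S ] F IsBD₃On S
  below-or-BD₃ with any? pinned-dec
  ... | yes (x , h) = inj₁ (pinned⇒below {x} h)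
  -- `fromℕ< 4≤n` serves as an arbitrary element of the ground set.
  ... | no ∄x = BD₃⇒ (unpinned⇒BD₃ (upClosure-upClosed F) (3-wise⇒2-wise F↑-spread F↑-3-wise) (fromℕ< 4≤n) missing)
    where
    missing : ∀ x → ∃[ A ] A ∈ᶠ F↑ × ∣ A ∣ ≡ 3 × x ∉ A
    missing x with pinned? 3 F↑ x
    ... | inj₁ h = contradiction (x , λ {A} → h {A}) ∄x
    ... | inj₂ found = found

------------------------------------------------------------------------
-- Real p

weightSum : (Subset n → ℚ) → Family n → List (Subset n) → ℚ
weightSum w F []ˡ = 0ℚ
weightSum w F (A ∷ˡ As) = (if F A then w A else 0ℚ) ℚ.+ weightSum w F As

seq-sumᴿ : ∀ (w : Subset n → ℝ) F k As →
  seq (sumᴿ (mapˡ w (filterᵇ F As))) k ≡ weightSum (λ A → seq (w A) k) F As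
seq-sumᴿ w F k []ˡ = refl
seq-sumᴿ w F k (A ∷ˡ As) with F A
... | true  = cong (seq (w A) k ℚ.+_) (seq-sumᴿ w F k As)
... | false = trans (seq-sumᴿ w F k As) (sym (ℚ.+-identityˡ _))

seq-^ᴿ : ∀ x j k → seq (x ^ᴿ j) k ≡ seq x k ^ j
seq-^ᴿ x zero    k = refl
seq-^ᴿ x (suc j) k = cong (seq x k ℚ.*_) (seq-^ᴿ x j k)

weightSum-cong : ∀ {w w′ : Subset n → ℚ} F → (∀ A → w A ≡ w′ A) → ∀ As → weightSum w F As ≡ weightSum w′ F As
weightSum-cong F w≗w′ []ˡ = refl
weightSum-cong F w≗w′ (A ∷ˡ As) =
  cong₂ (λ x y → (if F A then x else 0ℚ) ℚ.+ y) (w≗w′ A) (weightSum-cong F w≗w′ As)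

weightSum-++ : ∀ (w : Subset n → ℚ) F As Bs → weightSum w F (As ++ Bs) ≡ weightSum w F As ℚ.+ weightSum w F Bs
weightSum-++ w F []ˡ Bs = sym (ℚ.+-identityˡ _)
weightSum-++ w F (A ∷ˡ As) Bs = trans (cong (x ℚ.+_) (weightSum-++ w F As Bs))
  (sym (ℚ.+-assoc x (weightSum w F As) (weightSum w F Bs)))
  where x = if F A then w A else 0ℚ

weightSum-map : ∀ b {w : Subset (suc n) → ℚ} {w′ : Subset n → ℚ} {c} (F : Family (suc n)) →
  (∀ A → w (b ∷ A) ≡ c ℚ.* w′ A) → ∀ As → weightSum w F (mapˡ (b ∷_) As) ≡ c ℚ.* weightSum w′ (link b F) As
weightSum-map b {c = c} F w≡cw′ []ˡ = sym (ℚ.*-zeroʳ c)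
weightSum-map b {w} {w′} {c} F w≡cw′ (A ∷ˡ As) = trans
  (cong₂ ℚ._+_ (scaled (F (b ∷ A))) (weightSum-map b {w} {w′} {c} F w≡cw′ As))
  (sym (ℚ.*-distribˡ-+ c (if F (b ∷ A) then w′ A else 0ℚ) (weightSum w′ (link b F) As)))
  where
  scaled : ∀ t → (if t then w (b ∷ A) else 0ℚ) ≡ c ℚ.* (if t then w′ A else 0ℚ)
  scaled true  = w≡cw′ A
  scaled false = sym (ℚ.*-zeroʳ c)

weightSum-M : ∀ x y (F : Family n) → weightSum (λ A → x ^ ∣ A ∣ ℚ.* y ^ (n ℕ.∸ ∣ A ∣)) F (subsets n) ≡ M x y F
weightSum-M {zero} x y F with F []
... | true  = refl
... | false = refl
weightSum-M {suc n} x y F = trans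
  (weightSum-++ w F (mapˡ (inside ∷_) (subsets n)) (mapˡ (outside ∷_) (subsets n)))
  (cong₂ ℚ._+_
    (trans (weightSum-map inside {w} {w′} {x} F (λ A → ℚ.*-assoc x (x ^ ∣ A ∣) _) (subsets n))
      (cong (x ℚ.*_) (weightSum-M x y (link inside F))))
    (trans (weightSum-map outside {w} {w′} {y} F outside-weight (subsets n))
      (cong (y ℚ.*_) (weightSum-M x y (link outside F)))))
  where
  w : Subset (suc n) → ℚ
  w A = x ^ ∣ A ∣ ℚ.* y ^ (suc n ℕ.∸ ∣ A ∣)
  w′ : Subset n → ℚ
  w′ A = x ^ ∣ A ∣ ℚ.* y ^ (n ℕ.∸ ∣ A ∣)
  outside-weight : ∀ A → w (outside ∷ A) ≡ y ℚ.* w′ A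
  -- The truncated difference `suc n ∸ ∣ A ∣` is a successor because `∣ A ∣ ≤ n`.
  outside-weight A = trans (cong (λ j → x ^ ∣ A ∣ ℚ.* y ^ j) (ℕ.+-∸-assoc 1 (∣p∣≤n A)))
    (solve 3 (λ x y z → x :* (y :* z) := y :* (x :* z)) refl (x ^ ∣ A ∣) y (y ^ (n ℕ.∸ ∣ A ∣)))

seq-μ : ∀ p (F : Family n) k → seq (μ p F) k ≡ M (seq p k) (1ℚ ℚ.- seq p k) F
seq-μ {n} p F k = trans (seq-sumᴿ _ F k (subsets n)) (trans
  (weightSum-cong F (λ A → cong₂ ℚ._*_ (seq-^ᴿ p ∣ A ∣ k) (seq-^ᴿ _ (n ℕ.∸ ∣ A ∣) k)) (subsets n))
  (weightSum-M (seq p k) (1ℚ ℚ.- seq p k) F))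

-- Lipschitz dependence of the measure on p

lipschitz : ℕ → ℚ
lipschitz zero    = 0ℚ
lipschitz (suc n) = 1ℚ ℚ.+ lipschitz n

0≤lipschitz : ∀ n → 0ℚ ℚ.≤ lipschitz n
0≤lipschitz zero    = ℚ.≤-refl
0≤lipschitz (suc n) = from-yes (0ℚ ℚ.≤? 1ℚ) 0≤+ 0≤lipschitz n

-- η − a b = ½ ((η − a)(1 + b) + (η + a)(1 − b)), with a = x − y and b the difference of the links
M-lipschitz : ∀ {x y η} → 0ℚ ℚ.≤ x → x ℚ.≤ 1ℚ → 0ℚ ℚ.≤ y → y ℚ.≤ 1ℚ → x ℚ.≤ y ℚ.+ η → y ℚ.≤ x ℚ.+ η →
  (F : Family n) → M x (1ℚ ℚ.- x) F ℚ.≤ M y (1ℚ ℚ.- y) F ℚ.+ lipschitz n ℚ.* η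
M-lipschitz {zero} {η = η} _ _ _ _ _ _ F = ℚ.≤-reflexive (sym (trans
  (cong (M {0} 0ℚ 0ℚ F ℚ.+_) (ℚ.*-zeroˡ η)) (ℚ.+-identityʳ _)))
M-lipschitz {suc n} {x} {y} {η} 0≤x x≤1 0≤y y≤1 x≤y+η y≤x+η F =
  ≤-by (from-yes (0ℚ ℚ.≤? ℚ.½) 0≤* (0≤- x≤y+η 0≤* (0≤M 0≤x (0≤- x≤1) F₁ 0≤+ 0≤- (M≤1 0≤x (0≤- x≤1) (p+[1-p]≡1 x) F₀))
          0≤+ 0≤- y≤x+η 0≤* (0≤M 0≤x (0≤- x≤1) F₀ 0≤+ 0≤- (M≤1 0≤x (0≤- x≤1) (p+[1-p]≡1 x) F₁)))
        0≤+ 0≤y 0≤* 0≤- (M-lipschitz 0≤x x≤1 0≤y y≤1 x≤y+η y≤x+η F₁)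
        0≤+ 0≤- y≤1 0≤* 0≤- (M-lipschitz 0≤x x≤1 0≤y y≤1 x≤y+η y≤x+η F₀))
    (solve 8 (λ x y η L x₁ x₀ y₁ y₀ →
      y :* y₁ :+ (con 1ℚ :- y) :* y₀ :+ (con 1ℚ :+ L) :* η := x :* x₁ :+ (con 1ℚ :- x) :* x₀ :+
        (con ℚ.½ :* ((y :+ η :- x) :* (x₁ :+ (con 1ℚ :- x₀)) :+ (x :+ η :- y) :* (x₀ :+ (con 1ℚ :- x₁))) :+
         y :* (y₁ :+ L :* η :- x₁) :+ (con 1ℚ :- y) :* (y₀ :+ L :* η :- x₀))) refl x y η (lipschitz n)
      (M x (1ℚ ℚ.- x) F₁) (M x (1ℚ ℚ.- x) F₀) (M y (1ℚ ℚ.- y) F₁) (M y (1ℚ ℚ.- y) F₀))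
  where
  F₁ = link inside F
  F₀ = link outside F

<-+pos : ∀ x {ε} → 0ℚ ℚ.< ε → x ℚ.< x ℚ.+ ε
<-+pos x {ε} 0<ε = subst (ℚ._< x ℚ.+ ε) (ℚ.+-identityʳ x) (ℚ.+-monoʳ-< x 0<ε)

-- The terms of a sequence in ℝ between 1/3 and 1/2 may fall slightly outside that interval.
module _ {p : ℝ} (⅓≤p : fromℚ (+ 1 / 3) ≤ᴿ p) (p≤½ : p ≤ᴿ fromℚ (+ 1 / 2)) where

  clamp : ∀ {η} → 0ℚ ℚ.< η → ∃[ N ] (∀ {k} → N ℕ.≤ k →
    ∃[ x ] + 1 / 3 ℚ.≤ x × x ℚ.≤ + 1 / 2 × seq p k ℚ.≤ x ℚ.+ η × x ℚ.≤ seq p k ℚ.+ η)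
  clamp {η} 0<η =
    let N₁ , lower = ⅓≤p 0<η
        N₂ , upper = p≤½ 0<η
    in N₁ ℕ.⊔ N₂ , λ {k} N≤k →
       clamped (seq p k) (ℚ.<⇒≤ (lower (ℕ.m⊔n≤o⇒m≤o N₁ N₂ N≤k))) (ℚ.<⇒≤ (upper (ℕ.m⊔n≤o⇒n≤o N₁ N₂ N≤k)))
    where
    ≤+η : ∀ x → x ℚ.≤ x ℚ.+ η
    ≤+η x = ℚ.<⇒≤ (<-+pos x 0<η)
    clamped : ∀ y → + 1 / 3 ℚ.≤ y ℚ.+ η → y ℚ.≤ (+ 1 / 2) ℚ.+ η →
      ∃[ x ] + 1 / 3 ℚ.≤ x × x ℚ.≤ + 1 / 2 × y ℚ.≤ x ℚ.+ η × x ℚ.≤ y ℚ.+ η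
    clamped y ⅓≤y+η y≤½+η with + 1 / 3 ℚ.≤? y | y ℚ.≤? + 1 / 2
    ... | yes ⅓≤y | yes y≤½ = y , ⅓≤y , y≤½ , ≤+η y , ≤+η y
    ... | no ⅓≰y | _ = + 1 / 3 , ℚ.≤-refl , from-yes (+ 1 / 3 ℚ.≤? + 1 / 2) ,
                       ℚ.≤-trans (ℚ.<⇒≤ (ℚ.≰⇒> ⅓≰y)) (≤+η _) , ⅓≤y+η
    ... | yes ⅓≤y | no y≰½ = + 1 / 2 , from-yes (+ 1 / 3 ℚ.≤? + 1 / 2) , ℚ.≤-refl ,
                       y≤½+η , ℚ.≤-trans (ℚ.<⇒≤ (ℚ.≰⇒> y≰½)) (≤+η y)

  -- The assumption is applied at the clamped point `x`; moving both measures from `x` to the term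
  -- `y` costs at most `L η` each.
  eventually-< : {F G : Family n} → ∀ {g} →
    (∀ {x} → + 1 / 3 ℚ.≤ x → x ℚ.≤ + 1 / 2 → M x (1ℚ ℚ.- x) F ℚ.+ g ℚ.≤ M x (1ℚ ℚ.- x) G) →
    ∀ {ε} → 0ℚ ℚ.< ε → ∃[ N ] (∀ {k} → N ℕ.≤ k → seq (μ p F) k ℚ.+ g ℚ.< seq (μ p G) k ℚ.+ ε)
  eventually-< {n} {F} {G} {g} F+g≤G {ε} 0<ε =
    let N , near = clamp 0<η₀
    in N , λ {k} N≤k →
       let y = seq p k
           x , ⅓≤x , x≤½ , y≤x+η₀ , x≤y+η₀ = near N≤k
           0≤x = ℚ.≤-trans (from-yes (0ℚ ℚ.≤? + 1 / 3)) ⅓≤x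
           x≤1 = ℚ.≤-trans x≤½ (from-yes (+ 1 / 2 ℚ.≤? 1ℚ))
           0≤y = z≤y+z⇒0≤y (+ 1 / 3) (ℚ.≤-trans ⅓≤x (ℚ.≤-trans x≤y+η₀ (ℚ.+-monoʳ-≤ y η₀≤⅓)))
           y≤1 = ℚ.≤-trans y≤x+η₀ (ℚ.≤-trans (ℚ.+-mono-≤ x≤½ η₀≤⅓) (from-yes ((+ 1 / 2) ℚ.+ (+ 1 / 3) ℚ.≤? 1ℚ)))
           y≤x+η = ℚ.≤-trans y≤x+η₀ (ℚ.+-monoʳ-≤ x η₀≤η)
           x≤y+η = ℚ.≤-trans x≤y+η₀ (ℚ.+-monoʳ-≤ y η₀≤η)
       in subst₂ (λ s t → s ℚ.+ g ℚ.< t ℚ.+ ε) (sym (seq-μ p F k)) (sym (seq-μ p G k))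
            (combine {M y (1ℚ ℚ.- y) F} {M x (1ℚ ℚ.- x) F} {M x (1ℚ ℚ.- x) G} {M y (1ℚ ℚ.- y) G}
              (M-lipschitz 0≤y y≤1 0≤x x≤1 y≤x+η x≤y+η F) (F+g≤G ⅓≤x x≤½)
              (M-lipschitz 0≤x x≤1 0≤y y≤1 x≤y+η y≤x+η G))
    where
    L = lipschitz n
    -- Two errors of `L η` and one more `η` for strictness add up to `K η = ε`.
    K = 1ℚ ℚ.+ (L ℚ.+ L)
    instance
      K-positive : ℚ.Positive K
      K-positive = ℚ.positive (ℚ.<-≤-trans (from-yes (0ℚ ℚ.<? 1ℚ))
        (ℚ.+-monoʳ-≤ 1ℚ (0≤lipschitz n 0≤+ 0≤lipschitz n)))
      K-nonZero : ℚ.NonZero K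
      K-nonZero = ℚ.pos⇒nonZero K
    η = ℚ.1/ K ℚ.* ε
    -- The cap 1/3 keeps `y` between 1/3 - 1/3 and 1/2 + 1/3, hence between 0 and 1.
    η₀ = η ℚ.⊓ (+ 1 / 3)
    0<η : 0ℚ ℚ.< η
    0<η = ℚ.positive⁻¹ η {{ℚ.pos*pos⇒pos (ℚ.1/ K) {{ℚ.1/pos⇒pos K}} ε {{ℚ.positive 0<ε}}}}
    0<η₀ : 0ℚ ℚ.< η₀
    0<η₀ = [ (λ eq → subst (0ℚ ℚ.<_) (sym eq) 0<η) , (λ eq → subst (0ℚ ℚ.<_) (sym eq) (from-yes (0ℚ ℚ.<? + 1 / 3))) ]′
      (ℚ.⊓-sel η (+ 1 / 3))
    η₀≤η : η₀ ℚ.≤ η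
    η₀≤η = ℚ.p⊓q≤p η (+ 1 / 3)
    η₀≤⅓ : η₀ ℚ.≤ + 1 / 3
    η₀≤⅓ = ℚ.p⊓q≤q η (+ 1 / 3)
    Kη≡ε : K ℚ.* η ≡ ε
    Kη≡ε = trans (sym (ℚ.*-assoc K (ℚ.1/ K) ε)) (trans (cong (ℚ._* ε) (ℚ.*-inverseʳ K)) (ℚ.*-identityˡ ε))
    z≤y+z⇒0≤y : ∀ z {y} → z ℚ.≤ y ℚ.+ z → 0ℚ ℚ.≤ y
    z≤y+z⇒0≤y z {y} z≤y+z = subst (0ℚ ℚ.≤_) (cancel y z) (0≤- z≤y+z)
      where
      cancel : ∀ y z → y ℚ.+ z ℚ.- z ≡ y
      cancel = solve 2 (λ y z → y :+ z :- z := y) refl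
    combine : ∀ {a b c d} → a ℚ.≤ b ℚ.+ L ℚ.* η → b ℚ.+ g ℚ.≤ c → c ℚ.≤ d ℚ.+ L ℚ.* η → a ℚ.+ g ℚ.< d ℚ.+ ε
    combine {a} {b} {c} {d} a≤b b≤c c≤d = ℚ.≤-<-trans
      (≤-by (0≤- a≤b 0≤+ 0≤- b≤c 0≤+ 0≤- c≤d)
        (solve 7 (λ a b c d g L η → d :+ (L :+ L) :* η := a :+ g :+
          ((b :+ L :* η :- a) :+ (c :- (b :+ g)) :+ (d :+ L :* η :- c))) refl a b c d g L η))
      (subst (d ℚ.+ (L ℚ.+ L) ℚ.* η ℚ.<_)
        (trans (solve 3 (λ d L η → d :+ (L :+ L) :* η :+ η := d :+ (con 1ℚ :+ (L :+ L)) :* η) refl d L η) (cong (d ℚ.+_) Kη≡ε))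
        (<-+pos (d ℚ.+ (L ℚ.+ L) ℚ.* η) 0<η))
      where open +-*-Solver using (solve; con; _:+_; _:*_; _:-_; _:=_)

-- Maximality and uniqueness for real p

≃-refl : ∀ {x} → x ≃ x
≃-refl {x} {ε} 0<ε = 0 , λ {k} _ → subst (ℚ._< ε) (sym (cong ℚ.∣_∣ (ℚ.+-inverseʳ (seq x k)))) 0<ε

-x≤∣x∣ : ∀ x → ℚ.- x ℚ.≤ ℚ.∣ x ∣
-x≤∣x∣ x with ℚ.∣p∣≡p∨∣p∣≡-p x
... | inj₂ ∣x∣≡-x = ℚ.≤-reflexive (sym ∣x∣≡-x)
... | inj₁ ∣x∣≡x = ℚ.≤-trans (ℚ.neg-antimono-≤ (ℚ.∣p∣≡p⇒0≤p ∣x∣≡x)) (ℚ.0≤∣p∣ x)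

module _ {p : ℝ} (4≤n : 4 ≤ n) (⅓≤p : fromℚ (+ 1 / 3) ≤ᴿ p) (p≤½ : p ≤ᴿ fromℚ (+ 1 / 2)) where

  BD₃-measure : ∀ x → M x (1ℚ ℚ.- x) (BD₃ n) ≡ BDMeasure x
  BD₃-measure x = M-BD₃ x {BD₃ n} {[4]} (BD₃-isBD₃On 4≤n)

  below-BD₃ : ∀ {F} → BelowBD₃ F → ∀ {ε} → 0ℚ ℚ.< ε →
    ∃[ N ] (∀ {k} → N ℕ.≤ k → seq (μ p F) k ℚ.+ δ ^ n ℚ.< seq (μ p (BD₃ n)) k ℚ.+ ε)
  below-BD₃ {F} F<BD₃ = eventually-< {p} ⅓≤p p≤½ {n} {F} {BD₃ n} {δ ^ n} λ {x} ⅓≤x x≤½ →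
    subst (M x (1ℚ ℚ.- x) F ℚ.+ δ ^ n ℚ.≤_) (sym (BD₃-measure x)) (F<BD₃ ⅓≤x x≤½)

  μ-isBD₃ : ∀ {F : Family n} {S} → F IsBD₃On S → ∀ k → seq (μ p F) k ≡ seq (μ p (BD₃ n)) k
  μ-isBD₃ {F} {S} isBD₃ k = trans (seq-μ p F k) (trans (M-BD₃ (seq p k) {F} {S} isBD₃)
    (trans (sym (BD₃-measure (seq p k))) (sym (seq-μ p (BD₃ n) k))))

  BD₃-maximal : (F : Family n) → NonTrivial F → 3-WiseIntersecting F → μ p F ≤ᴿ μ p (BD₃ n)
  BD₃-maximal F nt w {ε} 0<ε = [ below , on ]′ (below-or-BD₃ 4≤n nt w)
    where
    Eventually≤ : Set
    Eventually≤ = ∃[ N ] (∀ {k} → N ℕ.≤ k → seq (μ p F) k ℚ.< seq (μ p (BD₃ n)) k ℚ.+ ε)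
    below : BelowBD₃ F → Eventually≤
    below F<BD₃ =
      let N , h = below-BD₃ {F} F<BD₃ 0<ε
      in N , λ {k} N≤k → ℚ.≤-<-trans
           (≤-by {seq (μ p F) k} {seq (μ p F) k ℚ.+ δ ^ n} {δ ^ n} (0≤^ 0≤δ n) refl) (h {k} N≤k)
    on : ∃[ S ] F IsBD₃On S → Eventually≤
    on (S , isBD₃) = 0 , λ {k} _ → subst (ℚ._< seq (μ p (BD₃ n)) k ℚ.+ ε)
      (sym (μ-isBD₃ {F} {S} isBD₃ k)) (<-+pos (seq (μ p (BD₃ n)) k) 0<ε)

  private
    ε : ℚ
    -- The three comparisons in `not-close` lose less than `3 ε` in all, which is less than the gap
    -- `δ ^ n`.
    ε = (+ 1 / 4) ℚ.* δ ^ n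

    0<δ^ : ∀ j → 0ℚ ℚ.< δ ^ j
    0<δ^ zero    = from-yes (0ℚ ℚ.<? 1ℚ)
    0<δ^ (suc j) = ℚ.*-monoʳ-<-pos δ (0<δ^ j)

    0<ε : 0ℚ ℚ.< ε
    0<ε = ℚ.*-monoʳ-<-pos (+ 1 / 4) (0<δ^ n)

    not-close : ∀ f b m → f ℚ.+ δ ^ n ℚ.< b ℚ.+ ε → b ℚ.< m ℚ.+ ε → ¬ ℚ.∣ f ℚ.- m ∣ ℚ.< ε
    not-close f b m f<b b<m ∣f-m∣<ε = ℚ.<-asym 0<ε (subst₂ ℚ._<_
      (solve 4 (λ f b m g → ((f :+ g) :+ b) :+ :- (f :- m) :- (b :+ m :+ con (+ 3 / 4) :* g) := con (+ 1 / 4) :* g) refl f b m (δ ^ n))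
      (solve 4 (λ f b m g → ((b :+ con (+ 1 / 4) :* g) :+ (m :+ con (+ 1 / 4) :* g)) :+ con (+ 1 / 4) :* g :-
          (b :+ m :+ con (+ 3 / 4) :* g) := con 0ℚ) refl f b m (δ ^ n))
      (ℚ.+-monoˡ-< (ℚ.- (b ℚ.+ m ℚ.+ (+ 3 / 4) ℚ.* δ ^ n))
        (ℚ.+-mono-< (ℚ.+-mono-< f<b b<m) (ℚ.≤-<-trans (-x≤∣x∣ (f ℚ.- m)) ∣f-m∣<ε))))

  -- A family below BD₃ stays `δ ^ n` short of `μ p (BD₃ n)`, up to `ε`, and so cannot have measure
  -- `m`.
  BD₃-unique : {F : Family n} → NonTrivial F → 3-WiseIntersecting F →
    (m : ℝ) → μ p (BD₃ n) ≤ᴿ m → μ p F ≃ m → F ≅ BD₃ n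
  BD₃-unique {F} nt w m BD₃≤m F≃m = [ ⊥-elim ∘ ¬below
      , (λ (S , isBD₃) → isBD₃On⇒≅ {F = F} {BD₃ n} {S} {[4]} isBD₃ (BD₃-isBD₃On 4≤n)) ]′
    (below-or-BD₃ 4≤n nt w)
    where
    ¬below : ¬ BelowBD₃ F
    ¬below F<BD₃ =
      let N₁ , h₁ = below-BD₃ {F} F<BD₃ 0<ε
          N₂ , h₂ = BD₃≤m 0<ε
          N₃ , h₃ = F≃m 0<ε
          k = N₁ ℕ.⊔ (N₂ ℕ.⊔ N₃)
          N₂₃≤k = ℕ.m≤n⊔m N₁ (N₂ ℕ.⊔ N₃)
      in not-close (seq (μ p F) k) (seq (μ p (BD₃ n)) k) (seq m k)
           (h₁ {k} (ℕ.m≤m⊔n N₁ (N₂ ℕ.⊔ N₃))) (h₂ {k} (ℕ.≤-trans (ℕ.m≤m⊔n N₂ N₃) N₂₃≤k))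
           (h₃ {k} (ℕ.≤-trans (ℕ.m≤n⊔m N₂ N₃) N₂₃≤k))

theorem4 : (n : ℕ) → 4 ≤ n →
    (p : ℝ) → fromℚ (+ 1 / 3) ≤ᴿ p → p ≤ᴿ fromℚ (+ 1 / 2) →
    IsM₃ n p (μ p (BD₃ n))
    × ((𝓕 : Family n) → NonTrivial 𝓕 → 3-WiseIntersecting 𝓕 →
    (m : ℝ) → IsM₃ n p m → μ p 𝓕 ≃ m → 𝓕 ≅ BD₃ n)
theorem4 n 4≤n p ⅓≤p p≤½ =
    ( (BD₃ n , nonTrivial , (λ {A} {B} {C} → 3-wise {A} {B} {C}) , λ {ε} → ≃-refl {μ p (BD₃ n)} {ε})
    , BD₃-maximal 4≤n ⅓≤p p≤½ )
  , λ 𝓕 nt w m (_ , m-max) → BD₃-unique {p = p} 4≤n ⅓≤p p≤½ {𝓕} nt w m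
      (m-max (BD₃ n) nonTrivial (λ {A} {B} {C} → 3-wise {A} {B} {C}))
  where
  nonTrivial = BD₃-nonTrivial 4≤n
  3-wise : 3-WiseIntersecting (BD₃ n)
  3-wise {A} {B} {C} = BD₃-3-wise 4≤n {A} {B} {C}
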